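{- Let $G$ be an outer-1-planar graph. If $\Delta(G)=4$ and $\vartheta(G)\geq 3$, then $\chi'_l(G)=\chi'(G)=4$.
   Context: All graphs are finite, simple and undirected; $\Delta(G)$ is the maximum degree. A graph is outer-1-planar if it can be drawn in the plane so that all vertices lie on the outer face and each edge is crossed at most once; such a drawing is an outer-1-plane graph, and it is called good if its number of crossings is as small as possible among all such drawings. Each crossing $c$ in such a drawing is formed by two mutually crossing edges; let $M(c)$ be the set of the four end-vertices of these two edges. For distinct crossings $c_1,c_2$ of a drawing $G'$, define $d_{G'}(c_1,c_2)=\min\{d_{G}(v_1,v_2): v_1\in M(c_1), v_2\in M(c_2)\}$, where $d_G$ is the graph distance. The crossing distance $\vartheta(G)$ is the minimum of $d_{G'}(c_1,c_2)$ over all good drawings $G'$ of $G$ and all pairs of distinct crossings $c_1,c_2$ of $G'$; set $\vartheta(G)=\infty$ if $G$ has a good drawing with at most one crossing. $\chi'(G)$ is the edge chromatic number; $\chi'_l(G)$ is the list edge chromatic number, i.e. the least $k$ such that for every assignment of lists $L(e)$ with $|L(e)|=k$ to the edges there is a proper edge coloring $c$ with $c(e)\in L(e)$ for all $e$. -}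

module Defs where

open import Data.Nat using (ℕ; zero; suc; pred; _≤_; _<_; _<ᵇ_)
open import Data.Bool using (Bool; true; false; _∧_; _∨_; not; _xor_; if_then_else_; T)
open import Data.Fin using (Fin; toℕ; _≟_)
open import Data.Fin.Permutation using (Permutation′; _⟨$⟩ʳ_)
open import Data.List using (List; []; _∷_; length; map; allFin)
open import Data.Nat.ListAction using (sum)
open import Data.List.Membership.Propositional using (_∈_)
open import Data.List.Relation.Unary.Unique.Propositional using (Unique)
open import Data.Product using (Σ; ∃; ∃-syntax; _×_; _,_)
open import Data.Sum using (_⊎_)
open import Relation.Nullary using (¬_; does)
open import Relation.Binary.PropositionalEquality using (_≡_; _≢_)

record Graph (n : ℕ) : Set where
  field
    adj    : Fin n → Fin n → Bool
    sym    : ∀ u v → adj u v ≡ adj v u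
    irrefl : ∀ u → adj u u ≡ false
open Graph public

Edge : ∀ {n} → Graph n → Fin n → Fin n → Set
Edge G u v = T (adj G u v)

deg : ∀ {n} → Graph n → Fin n → ℕ
deg {n} G v = sum (map (λ w → if adj G v w then 1 else 0) (allFin n))

MaxDegree : ∀ {n} → Graph n → ℕ → Set
MaxDegree G k = (∀ v → deg G v ≤ k) × (∃[ v ] deg G v ≡ k)

data Walk {n} (G : Graph n) : Fin n → Fin n → ℕ → Set where
  here : ∀ {u} → Walk G u u 0
  step : ∀ {u v w k} → Edge G u v → Walk G v w k → Walk G u w (suc k)

DistLE : ∀ {n} → Graph n → ℕ → Fin n → Fin n → Set
DistLE G k u v = ∃[ j ] (j ≤ k × Walk G u v j)

-- Outer drawings: vertices placed on a circle in the cyclic order given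
-- by a permutation π (vertex v at position π v); the edges ab, cd cross
-- iff their four end-vertices are distinct and interleave.

Drawing : ℕ → Set
Drawing n = Permutation′ n

private
  pos : ∀ {n} → Drawing n → Fin n → ℕ
  pos π x = toℕ (π ⟨$⟩ʳ x)

  eqB : ∀ {n} → Fin n → Fin n → Bool
  eqB x y = does (x ≟ y)

sepB : ∀ {n} → Drawing n → Fin n → Fin n → Fin n → Bool
sepB π a b c =
  ((pos π a <ᵇ pos π c) ∧ (pos π c <ᵇ pos π b)) ∨
  ((pos π b <ᵇ pos π c) ∧ (pos π c <ᵇ pos π a))

crossB : ∀ {n} → Graph n → Drawing n → Fin n → Fin n → Fin n → Fin n → Bool
crossB G π a b c d =
  adj G a b ∧ adj G c d ∧
  not (eqB c a) ∧ not (eqB c b) ∧ not (eqB d a) ∧ not (eqB d b) ∧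
  (sepB π a b c xor sepB π a b d)

Cross : ∀ {n} → Graph n → Drawing n → Fin n → Fin n → Fin n → Fin n → Set
Cross G π a b c d = T (crossB G π a b c d)

SameEdge : ∀ {n} → Fin n → Fin n → Fin n → Fin n → Set
SameEdge a b c d = (a ≡ c × b ≡ d) ⊎ (a ≡ d × b ≡ c)

IsOuter1Plane : ∀ {n} → Graph n → Drawing n → Set
IsOuter1Plane G π = ∀ a b c d c' d' →
  Cross G π a b c d → Cross G π a b c' d' → SameEdge c d c' d'

IsOuter1Planar : ∀ {n} → Graph n → Set
IsOuter1Planar G = ∃[ π ] IsOuter1Plane G π

private
  countF : ∀ {n} → (Fin n → ℕ) → ℕ
  countF {n} f = sum (map f (allFin n))

  b2n : Bool → ℕ
  b2n b = if b then 1 else 0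

-- number of ordered 4-tuples (a,b,c,d) with ab crossed by cd;
-- this is 8 times the number of crossings of the drawing
crossCount8 : ∀ {n} → Graph n → Drawing n → ℕ
crossCount8 G π =
  countF (λ a → countF (λ b → countF (λ c → countF (λ d →
    b2n (crossB G π a b c d)))))

IsGood : ∀ {n} → Graph n → Drawing n → Set
IsGood G π = IsOuter1Plane G π ×
  (∀ π' → IsOuter1Plane G π' → crossCount8 G π ≤ crossCount8 G π')

SameCrossing : ∀ {n} → (a b c d a' b' c' d' : Fin n) → Set
SameCrossing a b c d a' b' c' d' =
  (SameEdge a b a' b' × SameEdge c d c' d') ⊎
  (SameEdge a b c' d' × SameEdge c d a' b')

-- ϑ(G) ≥ k (ϑ(G) = ∞ makes the condition vacuous, as it is here)
CrossingDistanceAtLeast : ∀ {n} → Graph n → ℕ → Set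
CrossingDistanceAtLeast G k = ∀ π → IsGood G π →
  ∀ a b c d a' b' c' d' →
  Cross G π a b c d → Cross G π a' b' c' d' →
  ¬ SameCrossing a b c d a' b' c' d' →
  ∀ x y → x ∈ (a ∷ b ∷ c ∷ d ∷ []) → y ∈ (a' ∷ b' ∷ c' ∷ d' ∷ []) →
  ¬ DistLE G (pred k) x y

-- Edge colourings (colours are natural numbers; c is read on edges,
-- c u v and c v u denote the colour of the edge uv)

ProperEdgeColouring : ∀ {n} → Graph n → (Fin n → Fin n → ℕ) → Set
ProperEdgeColouring G c =
  (∀ u v → Edge G u v → c u v ≡ c v u) ×
  (∀ u v w → Edge G u v → Edge G u w → v ≢ w → c u v ≢ c u w)

EdgeColourable : ∀ {n} → Graph n → ℕ → Set
EdgeColourable G k = ∃[ c ] (ProperEdgeColouring G c × (∀ u v → Edge G u v → c u v < k))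

EdgeChromaticNumber : ∀ {n} → Graph n → ℕ → Set
EdgeChromaticNumber G k = EdgeColourable G k × (∀ j → j < k → ¬ EdgeColourable G j)

IsListAssignment : ∀ {n} → Graph n → ℕ → (Fin n → Fin n → List ℕ) → Set
IsListAssignment G k L = ∀ u v → Edge G u v →
  (L u v ≡ L v u) × (length (L u v) ≡ k) × Unique (L u v)

EdgeChoosable : ∀ {n} → Graph n → ℕ → Set
EdgeChoosable G k = ∀ L → IsListAssignment G k L →
  ∃[ c ] (ProperEdgeColouring G c × (∀ u v → Edge G u v → c u v ∈ L u v))

ListEdgeChromaticNumber : ∀ {n} → Graph n → ℕ → Set
ListEdgeChromaticNumber G k = EdgeChoosable G k × (∀ j → j < k → ¬ EdgeChoosable G j)

{-# OPTIONS --safe #-}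

-- A list colouring problem for the edges of a small configuration is played as a game: a colour
-- is presented together with the set of edges whose lists contain it, and an independent part of
-- this set is coloured.  Winning against all such sets proves colourability from all lists, and
-- this is decided by computation.  Hence a minimal counterexample contains none of nineteen
-- configurations.
--
-- Its vertices are placed on a circle; consider an interval that no edge leaves except at its
-- ends.  Splitting it at the farthest neighbour of its left end, or at the far end of the edge
-- crossing the edge to this neighbour, one sees by induction on the length that it has one of
-- eight shapes, all containing few edges.  Here the distance of crossings excludes two
-- neighbouring parts that both contain a crossing.  For the whole circle all eight shapes are
-- impossible.
module Submission where

open import Defs hiding (sym; irrefl)
open import Data.Nat using (ℕ; zero; suc; _+_; _*_; _^_; _∸_; _≤_; _<_; _≡ᵇ_; _<ᵇ_; z≤n; s≤s; _≟_; _≤?_; _<?_)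
open import Data.Nat.Properties
open import Data.Nat.Induction using (<-wellFounded)
open import Data.Nat.ListAction using (sum)
open import Data.Nat.Solver using (module +-*-Solver)
open import Induction.WellFounded using (Acc; acc)
open import Data.Bool using (Bool; true; false; _∧_; _∨_; not; if_then_else_; T; T?)
open import Data.Bool.Properties using (T-∧; T-∨)
open import Data.Bool.ListAction using (any)
open import Data.Fin using (Fin; zero; suc; toℕ; fromℕ<; finToFun; funToFin; combine; remQuot) renaming (_≟_ to _≟F_)
open import Data.Fin.Properties using (toℕ-injective; toℕ<n; toℕ-fromℕ<; any?; all?; finToFun-funToFin; remQuot-combine)
open import Data.Fin.Permutation using (_⟨$⟩ʳ_; _⟨$⟩ˡ_; inverseˡ; inverseʳ)
open import Data.List using (List; []; _∷_; length; _++_; map; filter; take; upTo; allFin; cartesianProduct)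
open import Data.List.Properties using (filter-all; filter-notAll; length-++; length-map; length-take; length-upTo)
open import Data.List.Membership.Propositional using (_∈_; _∉_; lose; find)
open import Data.List.Membership.Propositional.Properties
open import Data.List.Membership.DecPropositional _≟_ using (_∈?_)
open import Data.List.Relation.Unary.Any as Any using (Any; here; there)
open import Data.List.Relation.Unary.All as All using (All; []; _∷_)
open import Data.List.Relation.Unary.AllPairs as AllPairs using (AllPairs; []; _∷_)
open import Data.List.Relation.Unary.Linked using (Linked; [-]; _∷_)
open import Data.List.Relation.Unary.Linked.Properties using (Linked⇒AllPairs)
open import Data.List.Relation.Unary.Unique.Propositional using (Unique)
import Data.List.Relation.Unary.Unique.Propositional.Properties as Unique
open import Data.List.Relation.Unary.Unique.DecPropositional _≟_ using (unique?)
open import Data.List.Relation.Binary.Pointwise using (Pointwise; []; _∷_)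
open import Data.Product as Product using (Σ-syntax; ∃; ∃-syntax; _×_; _,_; proj₁; proj₂; uncurry)
open import Data.Sum using (_⊎_; inj₁; inj₂; [_,_]′; swap)
open import Data.Empty using (⊥; ⊥-elim)
open import Data.Unit using (tt)
open import Function using (_∘_; id; Equivalence)
open import Relation.Nullary using (¬_; Dec; yes; no; does; ¬?)
open import Relation.Nullary.Decidable using (toWitness; _×-dec_; _⊎-dec_; _→-dec_; decidable-stable; map′)
open import Relation.Unary using (Decidable)
open import Relation.Binary using (IsStrictTotalOrder; tri<; tri≈; tri>)
import Relation.Binary.Construct.Flip.EqAndOrd as Flip
open import Relation.Binary.PropositionalEquality

-- The crossing distance ranges over all good drawings, and a subgraph may have good drawings
-- unrelated to those of the whole graph, so it is not evidently inherited. Therefore one good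
-- drawing is fixed once and for all, and the induction carries only what survives the deletion of
-- edges: degrees at most 4 and crossings far apart in this drawing. Deletion creates no crossing
-- and shortens no distance. Neither a drawing with fewest crossings nor a minimal counterexample is
-- constructed; both exist only up to double negation. This is harmless: colourability from given
-- finite lists is decidable by a finite search, which removes the double negation at the very end.
-- The number 3 enters because each shape with a crossing has an end-vertex of this crossing at, or
-- adjacent to, each end of its interval. Two such intervals with a common end would have crossings
-- at distance at most 2.

length-⊆ : ∀ {xs ys : List ℕ} → Unique xs → (∀ {x} → x ∈ xs → x ∈ ys) → length xs ≤ length ys
length-⊆ [] _ = z≤n
length-⊆ {x ∷ xs} (x∉ ∷ u) sub with ∈-∃++ (sub (here refl))
... | as , bs , refl = begin
  suc (length xs)                ≤⟨ s≤s (length-⊆ u sub′) ⟩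
  suc (length (as ++ bs))        ≡⟨ cong suc (length-++ as) ⟩
  suc (length as + length bs)    ≡⟨ sym (+-suc (length as) (length bs)) ⟩
  length as + length (x ∷ bs)    ≡⟨ sym (length-++ as) ⟩
  length (as ++ x ∷ bs)          ∎
  where
  open ≤-Reasoning
  sub′ : ∀ {y} → y ∈ xs → y ∈ as ++ bs
  sub′ {y} y∈ with ∈-++⁻ as (sub (there y∈))
  ... | inj₁ p = ∈-++⁺ˡ p
  ... | inj₂ (here refl) = ⊥-elim (All.lookup x∉ y∈ refl)
  ... | inj₂ (there p) = ∈-++⁺ʳ as p

length-filter-split : ∀ {P : ℕ → Set} (P? : Decidable P) xs →
  length xs ≡ length (filter P? xs) + length (filter (λ x → ¬? (P? x)) xs)
length-filter-split P? [] = refl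
length-filter-split P? (x ∷ xs) with does (P? x)
... | true = cong suc (length-filter-split P? xs)
... | false = trans (cong suc (length-filter-split P? xs)) (sym (+-suc _ _))

_∖_ : List ℕ → List ℕ → List ℕ
xs ∖ ys = filter (λ x → ¬? (x ∈? ys)) xs

length-∖ : ∀ {xs} → Unique xs → ∀ ys → length xs ≤ length ys + length (xs ∖ ys)
length-∖ {xs} u ys = begin
  length xs                                       ≡⟨ length-filter-split (_∈? ys) xs ⟩
  length (filter (_∈? ys) xs) + length (xs ∖ ys)  ≤⟨ +-monoˡ-≤ _ (length-⊆ (Unique.filter⁺ (_∈? ys) u) (λ p → proj₂ (∈-filter⁻ (_∈? ys) {xs = xs} p))) ⟩
  length ys + length (xs ∖ ys)                    ∎
  where open ≤-Reasoning

∈-∖⁻ : ∀ {x xs} ys → x ∈ xs ∖ ys → x ∈ xs × x ∉ ys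
∈-∖⁻ ys p = ∈-filter⁻ (λ x → ¬? (x ∈? ys)) p

∈-∖⁺ : ∀ {x xs} ys → x ∈ xs → x ∉ ys → x ∈ xs ∖ ys
∈-∖⁺ ys p q = ∈-filter⁺ (λ x → ¬? (x ∈? ys)) p q

∖-unique : ∀ {xs} ys → Unique xs → Unique (xs ∖ ys)
∖-unique ys u = Unique.filter⁺ (λ x → ¬? (x ∈? ys)) u

∖-disjoint : ∀ {xs} ys → (∀ {x} → x ∈ xs → x ∉ ys) → xs ∖ ys ≡ xs
∖-disjoint ys d = filter-all (λ x → ¬? (x ∈? ys)) (All.tabulate d)

-- Some element of xs avoids ys, by pigeonhole.
pick : ∀ {xs} → Unique xs → ∀ ys → length ys < length xs → ∃[ x ] (x ∈ xs × x ∉ ys)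
pick {xs} u ys lt with xs ∖ ys in eq
... | [] = ⊥-elim (<⇒≱ lt (subst (length xs ≤_) (trans (cong (λ zs → length ys + length zs) eq) (+-identityʳ _)) (length-∖ u ys)))
... | z ∷ zs = z , ∈-∖⁻ ys (subst (z ∈_) (sym eq) (here refl))

-- The list colouring game

-- it p q f is the edge pq, whose list has at least f colours.
data Item : Set where
  it : (p q f : ℕ) → Item

share : Item → Item → Bool
share (it p q _) (it r s _) = (p ≡ᵇ r) ∨ (p ≡ᵇ s) ∨ (q ≡ᵇ r) ∨ (q ≡ᵇ s)

size : Item → ℕ
size (it _ _ f) = f

shrink : Item → Item
shrink (it p q f) = it p q (f ∸ 1)

clashes : Item → List Item → ℕ
clashes x [] = 0
clashes x (y ∷ ys) = if share x y then suc (clashes x ys) else clashes x ys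

prune : List Item → List Item → List Item
prune pre [] = []
prune pre (x ∷ xs) =
  if (clashes x pre + clashes x xs) <ᵇ size x then prune pre xs else x ∷ prune (x ∷ pre) xs

-- Dropping an item leaves fewer clashes for those kept, so a further pass may drop more. The number
-- caps the passes; stopping early is sound.
settle : ℕ → List Item → List Item
settle zero st = st
settle (suc k) st = next (prune [] st)
  where
  next : List Item → List Item
  next st′ = if length st′ ≡ᵇ length st then st′ else settle k st′

Outcome : Set
Outcome = List Item × List Item

-- The items marked with true have the presented colour in their lists: those moved to I are
-- coloured, and st is what remains of the others.
outcomes : List (Bool × Item) → List Item → List Item → List Outcome
outcomes [] I st = (I , st) ∷ []
outcomes ((false , x) ∷ m) I st = outcomes m I (x ∷ st)
outcomes ((true , x) ∷ m) I st =
  (if any (share x) I then [] else outcomes m (x ∷ I) st) ++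
  (if 1 <ᵇ size x then outcomes m I (shrink x ∷ st) else [])

mutual
  -- A form of on-line list colouring: the answer to a colour must not depend on the rest of the
  -- lists, so the search runs over sets of items and not over list assignments. The number bounds
  -- the rounds.
  wins : ℕ → List Item → Bool
  wins zero st = false
  wins (suc n) st = present n (settle 5 st)

  present : ℕ → List Item → Bool
  present n [] = true
  present n (it _ _ zero ∷ xs) = false
  -- Colours may be played in any order, so the next one can be taken from the list of the first
  -- item; only the marks of the others are up to the adversary.
  present n (x ∷ xs) = adversary n xs ((true , x) ∷ [])

  adversary : ℕ → List Item → List (Bool × Item) → Bool
  adversary n [] m = respond n (outcomes m [] [])
  adversary n (x ∷ xs) m = adversary n xs ((true , x) ∷ m) ∧ adversary n xs ((false , x) ∷ m)

  -- Trying large independent sets first only serves to speed up the search.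
  respond : ℕ → List Outcome → Bool
  respond n os = ofSize n 4 os ∨ ofSize n 3 os ∨ ofSize n 2 os ∨ ofSize n 1 os

  ofSize : ℕ → ℕ → List Outcome → Bool
  ofSize n k [] = false
  ofSize n k ((I , st) ∷ os) = ((length I ≡ᵇ k) ∧ wins n st) ∨ ofSize n k os

-- Soundness of the game

Lists = ℕ → ℕ → List ℕ

Fits : Lists → List Item → Set
Fits L st = ∀ {p q f} → it p q f ∈ st → Unique (L p q) × f ≤ length (L p q)

-- An edge is identified by its two ends alone, because the size of its item changes in the course
-- of the game.
Colours : Lists → List Item → (ℕ → ℕ → ℕ) → Set
Colours L st c =
  (∀ {p q f} → it p q f ∈ st → c p q ∈ L p q) ×
  (∀ {p q f r s g} → it p q f ∈ st → it r s g ∈ st → T (share (it p q f) (it r s g)) →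
    ¬ (p ≡ r × q ≡ s) → c p q ≢ c r s)

Choosable : List Item → Set
Choosable st = ∀ L → Fits L st → ∃ (Colours L st)

∨-left : ∀ {a b} → T a → T (a ∨ b)
∨-left = Equivalence.from T-∨ ∘ inj₁

∨-right : ∀ {a b} → T b → T (a ∨ b)
∨-right = Equivalence.from T-∨ ∘ inj₂

∨-cases : ∀ {a b} → T (a ∨ b) → T a ⊎ T b
∨-cases = Equivalence.to T-∨

∧-pair : ∀ {a b} → T (a ∧ b) → T a × T b
∧-pair = Equivalence.to T-∧

choosable-≈ : ∀ {st st′} → (∀ {x} → x ∈ st → x ∈ st′) → (∀ {x} → x ∈ st′ → x ∈ st) →
  Choosable st′ → Choosable st
choosable-≈ sub sup ch L fits with ch L (fits ∘ sup)
... | c , inL , proper = c , inL ∘ sub , λ m m′ → proper (sub m) (sub m′)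

named : ℕ → ℕ → List Item → Bool
named r s [] = false
named r s (it p q _ ∷ I) = (p ≡ᵇ r) ∧ (q ≡ᵇ s) ∨ named r s I

named⁻ : ∀ {r s} I → T (named r s I) → ∃[ f ] it r s f ∈ I
named⁻ {r} {s} (it p q f ∷ I) t with ∨-cases t
... | inj₁ m with ∧-pair m
...   | e , e′ with ≡ᵇ⇒≡ p r e | ≡ᵇ⇒≡ q s e′
...   | refl | refl = f , here refl
named⁻ (it p q f ∷ I) t | inj₂ m with named⁻ I m
... | g , g∈ = g , there g∈

named⁺ : ∀ {r s f} {I} → it r s f ∈ I → T (named r s I)
named⁺ {r} {s} (here refl) = ∨-left (Equivalence.from T-∧ (≡⇒≡ᵇ r r refl , ≡⇒≡ᵇ s s refl))
named⁺ {I = it p q _ ∷ I} (there m) = ∨-right {(p ≡ᵇ _) ∧ (q ≡ᵇ _)} (named⁺ m)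

recolour : List Item → ℕ → (ℕ → ℕ → ℕ) → ℕ → ℕ → ℕ
recolour I k c r s = if named r s I then k else c r s

recolour-cases : ∀ I k c r s →
  ((∃[ f ] it r s f ∈ I) × recolour I k c r s ≡ k) ⊎
  ((∀ {f} → it r s f ∉ I) × recolour I k c r s ≡ c r s)
recolour-cases I k c r s with named r s I in eq
... | true = inj₁ (named⁻ I (subst T (sym eq) tt) , refl)
... | false = inj₂ ((λ m → subst T eq (named⁺ m)) , refl)

neighbourColours : Item → (ℕ → ℕ → ℕ) → List Item → List ℕ
neighbourColours x c [] = []
neighbourColours x c (it p q f ∷ st) =
  if share x (it p q f) then c p q ∷ neighbourColours x c st else neighbourColours x c st

length-neighbourColours : ∀ x c st → length (neighbourColours x c st) ≡ clashes x st
length-neighbourColours x c [] = refl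
length-neighbourColours x c (it p q f ∷ st) with share x (it p q f)
... | true = cong suc (length-neighbourColours x c st)
... | false = length-neighbourColours x c st

∈-neighbourColours : ∀ x c {st p q f} → it p q f ∈ st → T (share x (it p q f)) →
  c p q ∈ neighbourColours x c st
∈-neighbourColours x c {it p q f ∷ st} (here refl) t with share x (it p q f)
... | true = here refl
∈-neighbourColours x c {it p q f ∷ st} (there m) t with share x (it p q f)
... | true = there (∈-neighbourColours x c m t)
... | false = ∈-neighbourColours x c m t

≡ᵇ-sym : ∀ a b → T (a ≡ᵇ b) → T (b ≡ᵇ a)
≡ᵇ-sym a b t = ≡⇒≡ᵇ b a (sym (≡ᵇ⇒≡ a b t))

share-sym : ∀ x y → T (share x y) → T (share y x)
share-sym (it p q _) (it r s _) t with ∨-cases t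
... | inj₁ e = ∨-left (≡ᵇ-sym p r e)
... | inj₂ t₁ with ∨-cases t₁
...   | inj₁ e = ∨-right {r ≡ᵇ p} (∨-right {r ≡ᵇ q} (∨-left (≡ᵇ-sym p s e)))
...   | inj₂ t₂ with ∨-cases t₂
...     | inj₁ e = ∨-right {r ≡ᵇ p} (∨-left (≡ᵇ-sym q r e))
...     | inj₂ e = ∨-right {r ≡ᵇ p} (∨-right {r ≡ᵇ q} (∨-right {s ≡ᵇ p} (≡ᵇ-sym q s e)))

-- An item with more colours than neighbours can be coloured last.
choosable-last : ∀ x {st} → clashes x st < size x → Choosable st → Choosable (x ∷ st)
choosable-last x@(it p q f) {st} lt ch L fits with ch L (λ m → fits (there m))
... | c , inL , proper with pick (proj₁ (fits (here refl))) (neighbourColours x c st)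
        (subst (_< length (L p q)) (sym (length-neighbourColours x c st)) (<-≤-trans lt (proj₂ (fits (here refl)))))
...   | k , k∈ , k∉ = recolour (x ∷ []) k c , member , distinct
  where
  member : ∀ {r s g} → it r s g ∈ x ∷ st → recolour (x ∷ []) k c r s ∈ L r s
  member {r} {s} m with recolour-cases (x ∷ []) k c r s
  ... | inj₁ ((_ , here refl) , e) = subst (_∈ L r s) (sym e) k∈
  member (here refl) | inj₂ (n , e) = ⊥-elim (n (here refl))
  member {r} {s} (there m) | inj₂ (n , e) = subst (_∈ L r s) (sym e) (inL m)
  distinct : ∀ {r s g t u h} → it r s g ∈ x ∷ st → it t u h ∈ x ∷ st →
    T (share (it r s g) (it t u h)) → ¬ (r ≡ t × s ≡ u) →
    recolour (x ∷ []) k c r s ≢ recolour (x ∷ []) k c t u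
  distinct {r} {s} {g} {t} {u} {h} m m′ sh ne eq
    with recolour-cases (x ∷ []) k c r s | recolour-cases (x ∷ []) k c t u
  ... | inj₁ ((_ , here refl) , _) | inj₁ ((_ , here refl) , _) = ne (refl , refl)
  distinct m (here refl) sh ne eq | _ | inj₂ (n , _) = n (here refl)
  distinct (here refl) m′ sh ne eq | inj₂ (n , _) | _ = n (here refl)
  distinct m (there m′) sh ne eq | inj₁ ((_ , here refl) , e) | inj₂ (n , e′) =
    k∉ (subst (_∈ neighbourColours x c st) (sym (trans (sym e) (trans eq e′))) (∈-neighbourColours x c m′ sh))
  distinct {r} {s} {g} (there m) m′ sh ne eq | inj₂ (n , e) | inj₁ ((_ , here refl) , e′) =
    k∉ (subst (_∈ neighbourColours x c st) (trans (sym e) (trans eq e′)) (∈-neighbourColours x c m (share-sym (it r s g) x sh)))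
  distinct (there m) (there m′) sh ne eq | inj₂ (n , e) | inj₂ (n′ , e′) =
    proper m m′ sh ne (trans (sym e) (trans eq e′))

clashes-++ : ∀ x as bs → clashes x (as ++ bs) ≡ clashes x as + clashes x bs
clashes-++ x [] bs = refl
clashes-++ x (a ∷ as) bs with share x a
... | true = cong suc (clashes-++ x as bs)
... | false = clashes-++ x as bs

private
  shift⁺ : ∀ {x y : Item} as {bs} → x ∈ as ++ y ∷ bs → x ∈ y ∷ as ++ bs
  shift⁺ as m with ∈-++⁻ as m
  ... | inj₁ p = there (∈-++⁺ˡ p)
  ... | inj₂ (here e) = here e
  ... | inj₂ (there p) = there (∈-++⁺ʳ as p)

  shift⁻ : ∀ {x y : Item} as {bs} → x ∈ y ∷ as ++ bs → x ∈ as ++ y ∷ bs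
  shift⁻ as (here e) = ∈-++⁺ʳ as (here e)
  shift⁻ as (there m) with ∈-++⁻ as m
  ... | inj₁ p = ∈-++⁺ˡ p
  ... | inj₂ p = ∈-++⁺ʳ as (there p)

-- A dropped item is coloured after all others, including those dropped later; this is why its
-- clashes are counted against the kept items `pre` and the whole remainder `xs`.
prune-sound : ∀ pre xs → Choosable (pre ++ prune pre xs) → Choosable (pre ++ xs)
prune-sound pre [] ch = ch
prune-sound pre (x ∷ xs) ch with (clashes x pre + clashes x xs) <ᵇ size x in eq
... | true = choosable-≈ (shift⁺ pre) (shift⁻ pre) (choosable-last x
        (subst (_< size x) (sym (clashes-++ x pre xs)) (<ᵇ⇒< _ _ (subst T (sym eq) tt)))
        (prune-sound pre xs ch))
... | false = choosable-≈ (shift⁺ pre) (shift⁻ pre)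
        (prune-sound (x ∷ pre) xs (choosable-≈ (shift⁻ pre) (shift⁺ pre) ch))

settle-sound : ∀ k st → Choosable (settle k st) → Choosable st
settle-sound zero st ch = ch
settle-sound (suc k) st ch with length (prune [] st) ≡ᵇ length st
... | true = prune-sound [] st ch
... | false = prune-sound [] st (settle-sound k (prune [] st) ch)

Independent : List Item → Set
Independent = AllPairs (λ x y → ¬ T (share x y))

-- The invariant of one branch of `outcomes`: each marked edge is coloured or still present, and a
-- remaining item comes from one marked false with the same size or from one marked true with one
-- colour more.
record Reached (m : List (Bool × Item)) (I st I′ st′ : List Item) : Set where
  field
    covered  : ∀ {b p q f} → (b , it p q f) ∈ m → it p q f ∈ I′ ⊎ ∃[ g ] it p q g ∈ st′
    keepsI   : ∀ {x} → x ∈ I → x ∈ I′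
    keepsSt  : ∀ {x} → x ∈ st → x ∈ st′
    fromI    : ∀ {x} → x ∈ I′ → x ∈ I ⊎ (true , x) ∈ m
    fromSt   : ∀ {p q g} → it p q g ∈ st′ →
      it p q g ∈ st ⊎ (false , it p q g) ∈ m ⊎ ∃[ f ] ((true , it p q f) ∈ m × g ≡ f ∸ 1)
    indep    : Independent I → Independent I′
open Reached

free⇒All : ∀ x I → any (share x) I ≡ false → All (λ y → ¬ T (share x y)) I
free⇒All x [] eq = []
free⇒All x (y ∷ I) eq with share x y in sh
... | false = (λ t → subst T sh t) ∷ free⇒All x I eq

outcomes-sound : ∀ m I st {I′ st′} → (I′ , st′) ∈ outcomes m I st → Reached m I st I′ st′
outcomes-sound [] I st (here refl) = record
  { covered = λ () ; keepsI = id ; keepsSt = id ; fromI = inj₁ ; fromSt = inj₁ ; indep = id }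
outcomes-sound ((false , it p q f) ∷ m) I st o with outcomes-sound m I (it p q f ∷ st) o
... | r = record
  { covered = λ { (here refl) → inj₂ (f , keepsSt r (here refl)) ; (there n) → covered r n }
  ; keepsI = keepsI r
  ; keepsSt = keepsSt r ∘ there
  ; fromI = [ inj₁ , inj₂ ∘ there ]′ ∘ fromI r
  ; fromSt = λ n → case-st (fromSt r n)
  ; indep = indep r }
  where
  case-st : ∀ {p′ q′ g} →
    it p′ q′ g ∈ it p q f ∷ st ⊎ (false , it p′ q′ g) ∈ m ⊎ ∃[ h ] ((true , it p′ q′ h) ∈ m × g ≡ h ∸ 1) →
    it p′ q′ g ∈ st ⊎ (false , it p′ q′ g) ∈ (false , it p q f) ∷ m ⊎
      ∃[ h ] ((true , it p′ q′ h) ∈ (false , it p q f) ∷ m × g ≡ h ∸ 1)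
  case-st (inj₁ (here refl)) = inj₂ (inj₁ (here refl))
  case-st (inj₁ (there n)) = inj₁ n
  case-st (inj₂ (inj₁ n)) = inj₂ (inj₁ (there n))
  case-st (inj₂ (inj₂ (h , n , e))) = inj₂ (inj₂ (h , there n , e))
outcomes-sound ((true , it p q f) ∷ m) I st {I′} {st′} o
  with ∈-++⁻ (if any (share (it p q f)) I then [] else outcomes m (it p q f ∷ I) st) o
... | inj₁ o₁ with any (share (it p q f)) I in free
...   | false with outcomes-sound m (it p q f ∷ I) st o₁
...     | r = record
  { covered = λ { (here refl) → inj₁ (keepsI r (here refl)) ; (there n) → covered r n }
  ; keepsI = keepsI r ∘ there
  ; keepsSt = keepsSt r
  ; fromI = λ n → case-I (fromI r n)
  ; fromSt = λ n → [ inj₁ , inj₂ ∘ [ inj₁ ∘ there , (λ (h , n′ , e) → inj₂ (h , there n′ , e)) ]′ ]′ (fromSt r n)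
  ; indep = λ ind → indep r (free⇒All (it p q f) I free ∷ ind) }
  where
  case-I : ∀ {x} → x ∈ it p q f ∷ I ⊎ (true , x) ∈ m → x ∈ I ⊎ (true , x) ∈ (true , it p q f) ∷ m
  case-I (inj₁ (here refl)) = inj₂ (here refl)
  case-I (inj₁ (there n)) = inj₁ n
  case-I (inj₂ n) = inj₂ (there n)
outcomes-sound ((true , it p q f) ∷ m) I st o | inj₂ o₂ with 1 <ᵇ f
... | true with outcomes-sound m I (it p q (f ∸ 1) ∷ st) o₂
...   | r = record
  { covered = λ { (here refl) → inj₂ (f ∸ 1 , keepsSt r (here refl)) ; (there n) → covered r n }
  ; keepsI = keepsI r
  ; keepsSt = keepsSt r ∘ there
  ; fromI = [ inj₁ , inj₂ ∘ there ]′ ∘ fromI r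
  ; fromSt = λ n → case-st (fromSt r n)
  ; indep = indep r }
  where
  case-st : ∀ {p′ q′ g} →
    it p′ q′ g ∈ it p q (f ∸ 1) ∷ st ⊎ (false , it p′ q′ g) ∈ m ⊎ ∃[ h ] ((true , it p′ q′ h) ∈ m × g ≡ h ∸ 1) →
    it p′ q′ g ∈ st ⊎ (false , it p′ q′ g) ∈ (true , it p q f) ∷ m ⊎
      ∃[ h ] ((true , it p′ q′ h) ∈ (true , it p q f) ∷ m × g ≡ h ∸ 1)
  case-st (inj₁ (here refl)) = inj₂ (inj₂ (f , here refl , refl))
  case-st (inj₁ (there n)) = inj₁ n
  case-st (inj₂ (inj₁ n)) = inj₂ (inj₁ (there n))
  case-st (inj₂ (inj₂ (h , n , e))) = inj₂ (inj₂ (h , there n , e))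

independent⇒ : ∀ {I p q f r s g} → Independent I → it p q f ∈ I → it r s g ∈ I →
  T (share (it p q f) (it r s g)) → ¬ (p ≡ r × q ≡ s) → ⊥
independent⇒ (_ ∷ _) (here refl) (here refl) sh ne = ne (refl , refl)
independent⇒ (a ∷ _) (here refl) (there m) sh ne = All.lookup a m sh
independent⇒ {p = p} {q} {f} {r} {s} {g} (a ∷ _) (there m) (here refl) sh ne = All.lookup a m (share-sym (it p q f) (it r s g) sh)
independent⇒ (_ ∷ i) (there m) (there m′) sh ne = independent⇒ i m m′ sh ne

Agrees : Lists → ℕ → List (Bool × Item) → Set
Agrees L k m = ∀ {b p q f} → (b , it p q f) ∈ m →
  (b ≡ true → k ∈ L p q) × (b ≡ false → k ∉ L p q)

unmark : List (Bool × Item) → List Item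
unmark = map proj₂

module _ (L : Lists) (k : ℕ) where

  private
    L′ : Lists
    L′ p q = L p q ∖ (k ∷ [])

    L′-true : ∀ {p q f} → Unique (L p q) → f ≤ length (L p q) → f ∸ 1 ≤ length (L′ p q)
    L′-true {p} {q} u le = ∸-monoˡ-≤ 1 (≤-trans le (length-∖ u (k ∷ [])))

    L′-false : ∀ {p q f} → k ∉ L p q → f ≤ length (L p q) → f ≤ length (L′ p q)
    L′-false {p} {q} n le =
      subst (λ xs → _ ≤ length xs) (sym (∖-disjoint (k ∷ []) (λ { x∈ (here refl) → n x∈ }))) le

  -- `k` is struck from all lists before the play goes on, so the colouring of the remainder cannot
  -- clash with `I`. A list containing `k` gets shorter by one, which `outcomes` has accounted for;
  -- the others keep their lengths.
  round : ∀ {m I st} → Agrees L k m → (∀ {b p q f} → (b , it p q f) ∈ m → Unique (L p q) × f ≤ length (L p q)) →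
    Reached m [] [] I st → Choosable st → ∃ (Colours L (unmark m))
  round {m} {I} {st} agrees fits r ch with ch L′ fits′
    where
    fits′ : Fits L′ st
    fits′ n with fromSt r n
    ... | inj₂ (inj₁ n′) = ∖-unique (k ∷ []) (proj₁ (fits n′)) , L′-false (proj₂ (agrees n′) refl) (proj₂ (fits n′))
    ... | inj₂ (inj₂ (f , n′ , refl)) = ∖-unique (k ∷ []) (proj₁ (fits n′)) , L′-true (proj₁ (fits n′)) (proj₂ (fits n′))
  ... | c , inL , proper = recolour I k c , member , distinct
    where
    marked : ∀ {x} → x ∈ unmark m → ∃[ b ] (b , x) ∈ m
    marked = go m
      where
      go : ∀ m {x} → x ∈ unmark m → ∃[ b ] (b , x) ∈ m
      go ((b , _) ∷ m) (here refl) = b , here refl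
      go (_ ∷ m) (there n) with go m n
      ... | b , n′ = b , there n′
    rest : ∀ {p q f} → it p q f ∈ unmark m → (∀ {g} → it p q g ∉ I) → ∃[ g ] it p q g ∈ st
    rest n none with covered r (proj₂ (marked n))
    ... | inj₁ i = ⊥-elim (none i)
    ... | inj₂ g = g
    inI : ∀ {p q f} → it p q f ∈ I → k ∈ L p q
    inI n with fromI r n
    ... | inj₂ n′ = proj₁ (agrees n′) refl
    member : ∀ {p q f} → it p q f ∈ unmark m → recolour I k c p q ∈ L p q
    member {p} {q} n with recolour-cases I k c p q
    ... | inj₁ ((_ , i) , e) = subst (_∈ L p q) (sym e) (inI i)
    ... | inj₂ (none , e) = subst (_∈ L p q) (sym e) (proj₁ (∈-∖⁻ (k ∷ []) (inL (proj₂ (rest n none)))))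
    distinct : ∀ {p q f r s g} → it p q f ∈ unmark m → it r s g ∈ unmark m →
      T (share (it p q f) (it r s g)) → ¬ (p ≡ r × q ≡ s) → recolour I k c p q ≢ recolour I k c r s
    distinct {p} {q} {f} {t} {s} {g} n n′ sh ne eq with recolour-cases I k c p q | recolour-cases I k c t s
    ... | inj₁ ((_ , i) , e) | inj₁ ((_ , i′) , e′) = independent⇒ (indep r []) i i′ sh ne
    ... | inj₁ ((_ , i) , e) | inj₂ (none , e′) =
      proj₂ (∈-∖⁻ {xs = L t s} (k ∷ []) (inL (proj₂ (rest n′ none)))) (here (trans (sym e′) (trans (sym eq) e)))
    ... | inj₂ (none , e) | inj₁ ((_ , i) , e′) =
      proj₂ (∈-∖⁻ {xs = L p q} (k ∷ []) (inL (proj₂ (rest n none)))) (here (trans (sym e) (trans eq e′)))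
    ... | inj₂ (none , e) | inj₂ (none′ , e′) =
      proper (proj₂ (rest n none)) (proj₂ (rest n′ none′)) sh ne (trans (sym e) (trans eq e′))

Won : ℕ → List Outcome → Set
Won n os = ∃[ I ] ∃[ st ] ((I , st) ∈ os × T (wins n st))

ofSize-sound : ∀ n j os → T (ofSize n j os) → Won n os
ofSize-sound n j ((I , st) ∷ os) t with ∨-cases {(length I ≡ᵇ j) ∧ wins n st} t
... | inj₁ w = I , st , here refl , proj₂ (∧-pair {length I ≡ᵇ j} w)
... | inj₂ w with ofSize-sound n j os w
...   | I′ , st′ , o , w′ = I′ , st′ , there o , w′

respond-sound : ∀ n os → T (respond n os) → Won n os
respond-sound n os t with ∨-cases {ofSize n 4 os} t
... | inj₁ w = ofSize-sound n 4 os w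
... | inj₂ t₁ with ∨-cases {ofSize n 3 os} t₁
...   | inj₁ w = ofSize-sound n 3 os w
...   | inj₂ t₂ with ∨-cases {ofSize n 2 os} t₂
...     | inj₁ w = ofSize-sound n 2 os w
...     | inj₂ w = ofSize-sound n 1 os w

transfer : ∀ {x z : Item} {ys xs} → z ∈ ys ⊎ z ∈ x ∷ xs → z ∈ x ∷ ys ⊎ z ∈ xs
transfer (inj₁ y) = inj₁ (there y)
transfer (inj₂ (here e)) = inj₁ (here e)
transfer (inj₂ (there y)) = inj₂ y

mutual
  -- The list assignment takes the part of the adversary: a colour `k` of the first list is fixed,
  -- and asking of every further list whether it contains `k` selects one of the branches, all of
  -- which have been checked.
  wins-sound : ∀ n st → T (wins n st) → Choosable st
  wins-sound (suc n) st w = settle-sound 5 st (present-sound n (settle 5 st) w)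

  present-sound : ∀ n st → T (present n st) → Choosable st
  present-sound n [] w L fits = (λ _ _ → 0) , (λ ()) , λ ()
  present-sound n (x@(it p q (suc f)) ∷ xs) w L fits
    with pick (proj₁ (fits (here refl))) [] (≤-trans (s≤s z≤n) (proj₂ (fits (here refl))))
  ... | k , k∈ , _ = adversary-sound n L k xs ((true , x) ∷ []) w
        (λ { (here refl) → (λ _ → k∈) , λ () }) (λ { (here refl) → fits (here refl) }) (fits ∘ there)
        λ { (here refl) → inj₁ (here refl) ; (there m) → inj₂ m }

  -- `zs` is the state at the beginning of the round; its items move one by one from `xs` to `m`.
  adversary-sound : ∀ n L k xs m {zs} → T (adversary n xs m) → Agrees L k m →
    (∀ {b p q f} → (b , it p q f) ∈ m → Unique (L p q) × f ≤ length (L p q)) → Fits L xs →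
    (∀ {x} → x ∈ zs → x ∈ unmark m ⊎ x ∈ xs) → ∃ (Colours L zs)
  adversary-sound n L k [] m w agrees fits _ sub with respond-sound n (outcomes m [] []) w
  ... | I , st , o , w′ with round L k agrees fits (outcomes-sound m [] [] o) (wins-sound n st w′)
  ...   | c , inL , proper = c , inL ∘ sub′ , λ y z → proper (sub′ y) (sub′ z)
    where
    sub′ : ∀ {x} → x ∈ _ → x ∈ unmark m
    sub′ y with sub y
    ... | inj₁ z = z
  adversary-sound n L k (x@(it p q f) ∷ xs) m w agrees fits fits′ sub
    with ∧-pair {adversary n xs ((true , x) ∷ m)} w | k ∈? L p q
  ... | w₁ , _ | yes k∈ = adversary-sound n L k xs ((true , x) ∷ m) w₁
        (λ { (here refl) → (λ _ → k∈) , (λ ()) ; (there y) → agrees y })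
        (λ { (here refl) → fits′ (here refl) ; (there y) → fits y }) (fits′ ∘ there)
        (transfer ∘ sub)
  ... | _ , w₂ | no k∉ = adversary-sound n L k xs ((false , x) ∷ m) w₂
        (λ { (here refl) → (λ ()) , (λ _ → k∉) ; (there y) → agrees y })
        (λ { (here refl) → fits′ (here refl) ; (there y) → fits y }) (fits′ ∘ there)
        (transfer ∘ sub)

-- Critical graphs and reducible configurations

nbrs : (ℕ → ℕ → Bool) → ℕ → ℕ → List ℕ
nbrs E n u = filter (λ v → T? (E u v)) (upTo n)

Crossing : (ℕ → ℕ → Bool) → ℕ → ℕ → ℕ → ℕ → Set
Crossing E a b c d = a < b × b < c × c < d × T (E a c) × T (E b d)

data OneOf (a b c d : ℕ) : ℕ → Set where
  1st : OneOf a b c d a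
  2nd : OneOf a b c d b
  3rd : OneOf a b c d c
  4th : OneOf a b c d d

-- Two vertices are at distance at most 2 when this relates both to some `v`; thus `apart` speaks of
-- distance without walks.
Within1 : (ℕ → ℕ → Bool) → ℕ → ℕ → Set
Within1 E x v = x ≡ v ⊎ T (E x v)

-- A graph on the positions 0, …, n−1 of the outer circle.  As the end-vertices of two
-- different crossings are at distance at least 3, no edge is crossed twice.
record Plane (n : ℕ) : Set where
  field
    E       : ℕ → ℕ → Bool
    E-sym   : ∀ {u v} → T (E u v) → T (E v u)
    E-irr   : ∀ {u} → ¬ T (E u u)
    E-bound : ∀ {u v} → T (E u v) → u < n
    deg≤4   : ∀ v → length (nbrs E n v) ≤ 4
    apart   : ∀ {a b c d a′ b′ c′ d′ x y v} → Crossing E a b c d → Crossing E a′ b′ c′ d′ →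
      OneOf a b c d x → OneOf a′ b′ c′ d′ y → Within1 E x v → Within1 E y v →
      a ≡ a′ × b ≡ b′ × c ≡ c′ × d ≡ d′

  edgeCount : ℕ
  edgeCount = length (filter (λ (u , v) → T? (E u v)) (cartesianProduct (upTo n) (upTo n)))

  degree : ℕ → ℕ
  degree v = length (nbrs E n v)

  ∈-nbrs⁺ : ∀ {u v} → T (E u v) → v ∈ nbrs E n u
  ∈-nbrs⁺ {u} e = ∈-filter⁺ (λ v → T? (E u v)) (∈-upTo⁺ (E-bound (E-sym e))) e

  ∈-nbrs⁻ : ∀ {u v} → v ∈ nbrs E n u → T (E u v)
  ∈-nbrs⁻ {u} m = proj₂ (∈-filter⁻ (λ v → T? (E u v)) {xs = upTo n} m)

  nbrs-unique : ∀ u → Unique (nbrs E n u)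
  nbrs-unique u = Unique.filter⁺ (λ v → T? (E u v)) (Unique.upTo⁺ n)

  deg-≤ : ∀ {u} xs → (∀ {v} → T (E u v) → v ∈ xs) → degree u ≤ length xs
  deg-≤ {u} xs sub = length-⊆ (nbrs-unique u) (sub ∘ ∈-nbrs⁻)

  LongLists : Lists → Set
  LongLists L = ∀ {u v} → T (E u v) → L u v ≡ L v u × 4 ≤ length (L u v) × Unique (L u v)

  Colourable : Lists → Set
  Colourable L = Σ[ c ∈ (ℕ → ℕ → ℕ) ]
    ((∀ {u v} → T (E u v) → c u v ≡ c v u) ×
     (∀ {u v w} → T (E u v) → T (E u w) → v ≢ w → c u v ≢ c u w) ×
     (∀ {u v} → T (E u v) → c u v ∈ L u v))

open Plane public

filter-filter : ∀ {A : Set} {P Q : A → Set} (P? : Decidable P) (Q? : Decidable Q) → (∀ {x} → Q x → P x) →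
  ∀ xs → filter Q? (filter P? xs) ≡ filter Q? xs
filter-filter P? Q? Q⇒P [] = refl
filter-filter P? Q? Q⇒P (x ∷ xs) with P? x
... | yes p with does (Q? x)
...   | true = cong (x ∷_) (filter-filter P? Q? Q⇒P xs)
...   | false = filter-filter P? Q? Q⇒P xs
filter-filter P? Q? Q⇒P (x ∷ xs) | no ¬p with Q? x
...   | yes q = ⊥-elim (¬p (Q⇒P q))
...   | no _ = filter-filter P? Q? Q⇒P xs

∧-left : ∀ {a b} → T (a ∧ b) → T a
∧-left {a} = proj₁ ∘ ∧-pair {a}

∧-right : ∀ {a b} → T (a ∧ b) → T b
∧-right {a} = proj₂ ∘ ∧-pair {a}

module _ {n} (P : Plane n) {R : ℕ → ℕ → Set} (R? : ∀ u v → Dec (R u v)) (R-sym : ∀ {u v} → R u v → R v u) where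

  keep : ℕ → ℕ → Bool
  keep u v = E P u v ∧ not (does (R? u v))

  keep⇒E : ∀ {u v} → T (keep u v) → T (E P u v)
  keep⇒E = ∧-left

  keep⇒¬R : ∀ {u v} → T (keep u v) → ¬ R u v
  keep⇒¬R {u} {v} t r with R? u v
  ... | yes _ = ∧-right {E P u v} t
  ... | no ¬r = ¬r r

  keep⁺ : ∀ {u v} → T (E P u v) → ¬ R u v → T (keep u v)
  keep⁺ {u} {v} e ¬r with R? u v
  ... | yes r = ⊥-elim (¬r r)
  ... | no _ = Equivalence.from T-∧ (e , tt)

  -- Crossings and adjacencies of the smaller graph are present in the larger one, so `apart` is
  -- inherited.
  delete : Plane n
  delete = record
    { E = keep
    ; E-sym = λ {u} {v} t → keep⁺ (E-sym P (keep⇒E {u} {v} t)) (keep⇒¬R {u} {v} t ∘ R-sym)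
    ; E-irr = λ {u} t → E-irr P (keep⇒E {u} {u} t)
    ; E-bound = λ {u} {v} t → E-bound P (keep⇒E {u} {v} t)
    ; deg≤4 = λ v → ≤-trans (length-⊆ (Unique.filter⁺ (λ w → T? (keep v w)) (Unique.upTo⁺ n))
        (λ m → ∈-nbrs⁺ P (keep⇒E {v} (proj₂ (∈-filter⁻ (λ w → T? (keep v w)) {xs = upTo n} m))))) (deg≤4 P v)
    ; apart = λ X X′ o o′ w w′ → apart P (cross X) (cross X′) o o′ (within w) (within w′)
    }
    where
    cross : ∀ {a b c d} → Crossing keep a b c d → Crossing (E P) a b c d
    cross {a} {b} (p , q , r , e , f) = p , q , r , keep⇒E {a} e , keep⇒E {b} f
    within : ∀ {x v} → Within1 keep x v → Within1 (E P) x v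
    within {x} {v} = [ inj₁ , inj₂ ∘ keep⇒E {x} {v} ]′

  delete-< : ∀ {u v} → T (E P u v) → R u v → edgeCount delete < edgeCount P
  delete-< {u} {v} e r = subst (_< edgeCount P) (cong length same)
    (filter-notAll (λ (u , v) → T? (keep u v)) _ (lose uv∈ λ t → keep⇒¬R {u} {v} t r))
    where
    pairs = cartesianProduct (upTo n) (upTo n)
    uv∈ : (u , v) ∈ filter (λ (u , v) → T? (E P u v)) pairs
    uv∈ = ∈-filter⁺ (λ (u , v) → T? (E P u v))
      (∈-cartesianProduct⁺ (∈-upTo⁺ (E-bound P e)) (∈-upTo⁺ (E-bound P (E-sym P e)))) e
    same = filter-filter (λ (u , v) → T? (E P u v)) (λ (u , v) → T? (keep u v)) (λ {(u , v)} → keep⇒E {u} {v}) pairs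

  deg-delete : ∀ {u} xs → Unique xs → (∀ {v} → v ∈ xs → T (E P u v) × R u v) →
    length xs + degree delete u ≤ degree P u
  deg-delete {u} xs ux sub = begin
    length xs + degree delete u         ≡⟨ sym (length-++ xs) ⟩
    length (xs ++ nbrs keep n u)     ≤⟨ length-⊆ (Unique.++⁺ ux (nbrs-unique delete u) disjoint) sub′ ⟩
    degree P u                          ∎
    where
    open ≤-Reasoning
    disjoint : ∀ {v} → v ∈ xs × v ∈ nbrs keep n u → ⊥
    disjoint (m , m′) = keep⇒¬R (∈-nbrs⁻ delete m′) (proj₂ (sub m))
    sub′ : ∀ {v} → v ∈ xs ++ nbrs keep n u → v ∈ nbrs (E P) n u
    sub′ m with ∈-++⁻ xs m
    ... | inj₁ m′ = ∈-nbrs⁺ P (proj₁ (sub m′))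
    ... | inj₂ m′ = ∈-nbrs⁺ P (keep⇒E (∈-nbrs⁻ delete m′))

-- Configurations and their reduction

at : List ℕ → ℕ → ℕ
at [] _ = 0
at (v ∷ vs) zero = v
at (v ∷ vs) (suc p) = at vs p

index : List ℕ → ℕ → ℕ
index [] u = 0
index (v ∷ vs) u = if v ≡ᵇ u then 0 else suc (index vs u)

at-∈ : ∀ vs {p} → p < length vs → at vs p ∈ vs
at-∈ (v ∷ vs) {zero} lt = here refl
at-∈ (v ∷ vs) {suc p} (s≤s lt) = there (at-∈ vs lt)

index-at : ∀ {vs p} → Unique vs → p < length vs → index vs (at vs p) ≡ p
index-at {v ∷ vs} {zero} u lt with v ≡ᵇ v in e
... | true = refl
... | false = ⊥-elim (subst T e (≡⇒≡ᵇ v v refl))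
index-at {v ∷ vs} {suc p} (v∉ ∷ u) (s≤s lt) with v ≡ᵇ at vs p in e
... | true = ⊥-elim (All.lookup v∉ (at-∈ vs lt) (≡ᵇ⇒≡ v _ (subst T (sym e) tt)))
... | false = cong suc (index-at u lt)

-- A configuration on the vertices 0, …, m−1: an upper bound for the degree of each of
-- them in the whole graph, and the edges that are to be recoloured.
record Config : Set where
  constructor config
  field
    bounds : List ℕ
    links  : List (ℕ × ℕ)

  around : ℕ → List (ℕ × ℕ) → List ℕ
  around p [] = []
  around p ((a , b) ∷ l) =
    if a ≡ᵇ p then b ∷ around p l else (if b ≡ᵇ p then a ∷ around p l else around p l)

  -- At most at bounds p ∸ length (around p links) of the colours of pq are taken at p.
  room : ℕ → ℕ → ℕ
  room p q = (4 + (length (around p links) + length (around q links))) ∸ (at bounds p + at bounds q)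

  items : List Item
  items = map (λ (p , q) → it p q (room p q)) links

  Valid : Set
  Valid = 0 < length links ×
    All (λ (p , q) → p < q × q < length bounds) links ×
    All (λ p → Unique (around p links)) (upTo (length bounds))

  valid? : Dec Valid
  valid? = (0 <? length links) ×-dec
    (All.all? (λ (p , q) → (p <? q) ×-dec (q <? length bounds)) links ×-dec
     All.all? (λ p → unique? (around p links)) (upTo (length bounds)))

  ∈-around : ∀ p l {x} → x ∈ around p l → (p , x) ∈ l ⊎ (x , p) ∈ l
  ∈-around p ((a , b) ∷ l) m with a ≡ᵇ p in e₁ | b ≡ᵇ p in e₂
  ∈-around p ((a , b) ∷ l) (here refl) | true | _ = inj₁ (here (cong (_, b) (sym (≡ᵇ⇒≡ a p (subst T (sym e₁) tt)))))
  ∈-around p ((a , b) ∷ l) (there m) | true | _ = [ inj₁ ∘ there , inj₂ ∘ there ]′ (∈-around p l m)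
  ∈-around p ((a , b) ∷ l) (here refl) | false | true = inj₂ (here (cong (a ,_) (sym (≡ᵇ⇒≡ b p (subst T (sym e₂) tt)))))
  ∈-around p ((a , b) ∷ l) (there m) | false | true = [ inj₁ ∘ there , inj₂ ∘ there ]′ (∈-around p l m)
  ∈-around p ((a , b) ∷ l) m | false | false = [ inj₁ ∘ there , inj₂ ∘ there ]′ (∈-around p l m)

open Config public

-- `a` and `b` count the removed edges at the two ends, `x` and `y` the coloured edges left there,
-- and `l` the colours still free. The last premise holds since each coloured edge forbids at most
-- one of four colours.
room-bound : ∀ {x y a b D D′ l} → a + x ≤ D → b + y ≤ D′ → 4 ≤ (x + y) + l → (4 + (a + b)) ∸ (D + D′) ≤ l
room-bound {x} {y} {a} {b} {D} {D′} {l} p q r = begin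
  (4 + (a + b)) ∸ (D + D′)                    ≤⟨ ∸-monoʳ-≤ (4 + (a + b)) (+-mono-≤ p q) ⟩
  (4 + (a + b)) ∸ ((a + x) + (b + y))         ≤⟨ ∸-monoˡ-≤ ((a + x) + (b + y)) (+-monoˡ-≤ (a + b) r) ⟩
  (((x + y) + l) + (a + b)) ∸ ((a + x) + (b + y)) ≡⟨ cong (_∸ ((a + x) + (b + y))) (solve 5 (λ x y l a b → ((x :+ y) :+ l) :+ (a :+ b) := ((a :+ x) :+ (b :+ y)) :+ l) refl x y l a b) ⟩
  (((a + x) + (b + y)) + l) ∸ ((a + x) + (b + y)) ≡⟨ m+n∸m≡n ((a + x) + (b + y)) l ⟩
  l ∎
  where
  open ≤-Reasoning
  open +-*-Solver

-- A minimal counterexample for fixed lists: only the graph shrinks. `better` is double negated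
-- because it comes from a descent by contradiction; each use of it ends in a contradiction anyway.
record Critical {n} (P : Plane n) (L : Lists) : Set where
  field
    long   : LongLists P L
    stuck  : ¬ Colourable P L
    better : ∀ (P′ : Plane n) → edgeCount P′ < edgeCount P → LongLists P′ L → ¬ ¬ Colourable P′ L

module _ {n} {P : Plane n} {L : Lists} (crit : Critical P L) where
  open Critical crit

  -- Without the links the graph is colourable by criticality. Each link then retains the colours
  -- not seen at its two ends, at least `room` many, and choosability of the items completes the
  -- colouring.
  reduce : ∀ C → Choosable (items C) → Valid C → ∀ {vs} → Unique vs →
    All (λ (p , q) → T (E P (at vs p) (at vs q))) (links C) →
    Pointwise (λ v d → degree P v ≤ d) vs (bounds C) → ⊥
  reduce C choose (nonempty , ordered , unique) {vs} uvs edges degs =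
    better smaller (fewer (links C) refl nonempty) (λ {u} {v} e → long (keep⇒E P Removed? Removed-sym {u} {v} e)) extend
    where
    Match : ℕ → ℕ → ℕ × ℕ → Set
    Match u v (p , q) = (at vs p ≡ u × at vs q ≡ v) ⊎ (at vs p ≡ v × at vs q ≡ u)

    Removed : ℕ → ℕ → Set
    Removed u v = Any (Match u v) (links C)

    Removed? : ∀ u v → Dec (Removed u v)
    Removed? u v = Any.any? (λ (p , q) → ((at vs p ≟ u) ×-dec (at vs q ≟ v)) ⊎-dec ((at vs p ≟ v) ×-dec (at vs q ≟ u))) (links C)

    Removed-sym : ∀ {u v} → Removed u v → Removed v u
    Removed-sym = Any.map swap

    smaller : Plane n
    smaller = delete P Removed? Removed-sym

    same-length : ∀ {vs ds} → Pointwise (λ v d → degree P v ≤ d) vs ds → length vs ≡ length ds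
    same-length [] = refl
    same-length (_ ∷ pw) = cong suc (same-length pw)

    deg-at : ∀ {vs ds p} → Pointwise (λ v d → degree P v ≤ d) vs ds → p < length ds → degree P (at vs p) ≤ at ds p
    deg-at {p = zero} (le ∷ _) lt = le
    deg-at {p = suc p} (_ ∷ pw) (s≤s lt) = deg-at pw lt

    inside : ∀ {p} → p < length (bounds C) → p < length vs
    inside = subst (_ <_) (sym (same-length degs))

    index-at′ : ∀ {p} → p < length (bounds C) → index vs (at vs p) ≡ p
    index-at′ lt = index-at uvs (inside lt)

    at-injective : ∀ {p q} → p < length (bounds C) → q < length (bounds C) → at vs p ≡ at vs q → p ≡ q
    at-injective lp lq e = trans (sym (index-at′ lp)) (trans (cong (index vs) e) (index-at′ lq))

    link< : ∀ {p q} → (p , q) ∈ links C → p < q × p < length (bounds C) × q < length (bounds C)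
    link< m with All.lookup ordered m
    ... | p<q , q< = p<q , <-trans p<q q< , q<

    link-edge : ∀ {p q} → (p , q) ∈ links C → T (E P (at vs p) (at vs q))
    link-edge m = All.lookup edges m

    fewer : ∀ l → l ≡ links C → 0 < length l → edgeCount smaller < edgeCount P
    fewer ((p , q) ∷ l) refl _ = delete-< P Removed? Removed-sym (link-edge (here refl)) (here (inj₁ (refl , refl)))

    deg-smaller : ∀ {p} → p < length (bounds C) →
      length (around C p (links C)) + degree smaller (at vs p) ≤ at (bounds C) p
    deg-smaller {p} lt = ≤-trans (subst (λ k → k + degree smaller (at vs p) ≤ degree P (at vs p)) (length-map (at vs) ar)
      (deg-delete P Removed? Removed-sym (map (at vs) ar) unique-map inR)) (deg-at degs lt)
      where
      ar = around C p (links C)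
      other< : ∀ {x} → x ∈ ar → x < length (bounds C)
      other< m with ∈-around C p (links C) m
      ... | inj₁ l = proj₂ (proj₂ (link< l))
      ... | inj₂ l = proj₁ (proj₂ (link< l))
      map-unique : ∀ {xs} → Unique xs → (∀ {x} → x ∈ xs → x < length (bounds C)) → Unique (map (at vs) xs)
      map-unique [] _ = []
      map-unique (x∉ ∷ u) lts = All.tabulate (λ m e → apart′ m e) ∷ map-unique u (lts ∘ there)
        where
        apart′ : ∀ {y} → y ∈ _ → at vs _ ≡ y → ⊥
        apart′ m e with ∈-map⁻ (at vs) m
        ... | z , z∈ , refl = All.lookup x∉ z∈ (at-injective (lts (here refl)) (lts (there z∈)) e)
      unique-map : Unique (map (at vs) ar)
      unique-map = map-unique (All.lookup unique (∈-upTo⁺ lt)) other<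
      inR : ∀ {v} → v ∈ map (at vs) ar → T (E P (at vs p) v) × Removed (at vs p) v
      inR m with ∈-map⁻ (at vs) m
      ... | x , x∈ , refl with ∈-around C p (links C) x∈
      ...   | inj₁ l = link-edge l , lose l (inj₁ (refl , refl))
      ...   | inj₂ l = E-sym P (link-edge l) , lose l (inj₂ (refl , refl))

    extend : ¬ Colourable smaller L
    extend (c , c-sym , c-proper , c-list) = finish (choose Λ fits)
      where
      seen : ℕ → List ℕ
      seen u = map (c u) (nbrs (E smaller) n u)

      Λ : Lists
      Λ p q = L (at vs p) (at vs q) ∖ (seen (at vs p) ++ seen (at vs q))

      item⁻ : ∀ {p q f} → it p q f ∈ items C → (p , q) ∈ links C × f ≡ room C p q
      item⁻ m with ∈-map⁻ _ m
      ... | (p , q) , l , refl = l , refl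

      item⁺ : ∀ {p q} → (p , q) ∈ links C → it p q (room C p q) ∈ items C
      item⁺ = ∈-map⁺ (λ (p , q) → it p q (room C p q))

      fits : Fits Λ (items C)
      fits {p} {q} m with item⁻ m
      ... | l , refl with link< l | long (link-edge l)
      ...   | _ , p< , q< | _ , four , u = ∖-unique (seen (at vs p) ++ seen (at vs q)) u ,
        room-bound {degree smaller (at vs p)} {degree smaller (at vs q)} {length (around C p (links C))} {length (around C q (links C))}
          (deg-smaller p<) (deg-smaller q<) (subst (λ k → 4 ≤ k + length (Λ p q)) seen-length
          (≤-trans four (length-∖ u (seen (at vs p) ++ seen (at vs q)))))
        where
        seen-length : length (seen (at vs p) ++ seen (at vs q)) ≡ degree smaller (at vs p) + degree smaller (at vs q)
        seen-length = trans (length-++ (seen (at vs p)))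
          (cong₂ _+_ (length-map (c _) (nbrs (E smaller) n (at vs p))) (length-map (c _) (nbrs (E smaller) n (at vs q))))

      seen⁺ : ∀ {u v} → T (E smaller u v) → c u v ∈ seen u
      seen⁺ {u} e = ∈-map⁺ (c u) (∈-nbrs⁺ smaller e)

      finish : ∃ (Colours Λ (items C)) → ⊥
      finish (γ , γ-list , γ-proper) = stuck (κ , κ-sym , κ-proper , κ-list)
        where
        -- Links are written with the smaller number first, so the colouring of the items has a
        -- meaning in this direction only and must be made symmetric.
        γ′ : ℕ → ℕ → ℕ
        γ′ p q = if p <ᵇ q then γ p q else γ q p

        κ : ℕ → ℕ → ℕ
        κ u v = if does (Removed? u v) then γ′ (index vs u) (index vs v) else c u v

        γ′-up : ∀ {p q} → p < q → γ′ p q ≡ γ p q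
        γ′-up {p} {q} lt with p <ᵇ q in e
        ... | true = refl
        ... | false = ⊥-elim (subst T e (<⇒<ᵇ lt))

        γ′-down : ∀ {p q} → p < q → γ′ q p ≡ γ p q
        γ′-down {p} {q} lt with q <ᵇ p in e
        ... | true = ⊥-elim (<-asym lt (<ᵇ⇒< q p (subst T (sym e) tt)))
        ... | false = refl

        data View (u v : ℕ) : Set where
          new : ∀ {p q} → (p , q) ∈ links C → Match u v (p , q) → κ u v ≡ γ p q → View u v
          old : T (E smaller u v) → κ u v ≡ c u v → View u v

        view : ∀ {u v} → T (E P u v) → View u v
        view {u} {v} e with Removed? u v in eq
        ... | no ¬r = old (keep⁺ P Removed? Removed-sym e ¬r) (cong (λ d → if does d then γ′ (index vs u) (index vs v) else c u v) eq)
        ... | yes r with find r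
        ...   | (p , q) , l , m with link< l
        ...     | p<q , p< , q< = new l m (trans (cong (λ d → if does d then γ′ (index vs u) (index vs v) else c u v) eq) (colour m))
          where
          colour : Match u v (p , q) → γ′ (index vs u) (index vs v) ≡ γ p q
          colour (inj₁ (refl , refl)) = trans (cong₂ γ′ (index-at′ p<) (index-at′ q<)) (γ′-up p<q)
          colour (inj₂ (refl , refl)) = trans (cong₂ γ′ (index-at′ q<) (index-at′ p<)) (γ′-down p<q)

        same-link : ∀ {u v p q r s} → (p , q) ∈ links C → (r , s) ∈ links C →
          Match u v (p , q) → Match u v (r , s) → p ≡ r × q ≡ s
        same-link l l′ (inj₁ (refl , refl)) (inj₁ (e , e′)) with link< l | link< l′
        ... | _ , p< , q< | _ , r< , s< = at-injective p< r< (sym e) , at-injective q< s< (sym e′)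
        same-link l l′ (inj₂ (refl , refl)) (inj₂ (e , e′)) with link< l | link< l′
        ... | _ , p< , q< | _ , r< , s< = at-injective p< r< (sym e) , at-injective q< s< (sym e′)
        same-link l l′ (inj₁ (refl , refl)) (inj₂ (e , e′)) with link< l | link< l′
        ... | lt , p< , q< | lt′ , r< , s< = ⊥-elim (<-asym lt (subst₂ _<_ (at-injective r< q< e) (at-injective s< p< e′) lt′))
        same-link l l′ (inj₂ (refl , refl)) (inj₁ (e , e′)) with link< l | link< l′
        ... | lt , p< , q< | lt′ , r< , s< = ⊥-elim (<-asym lt (subst₂ _<_ (at-injective r< q< e) (at-injective s< p< e′) lt′))

        κ-sym : ∀ {u v} → T (E P u v) → κ u v ≡ κ v u
        κ-sym e with view e | view (E-sym P e)
        ... | new l m k | new l′ m′ k′ with same-link l l′ m (swap m′)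
        ...   | refl , refl = trans k (sym k′)
        κ-sym e | new l m k | old o k′ = ⊥-elim (keep⇒¬R P Removed? Removed-sym o (lose l (swap m)))
        κ-sym e | old o k | new l′ m′ k′ = ⊥-elim (keep⇒¬R P Removed? Removed-sym o (lose l′ (swap m′)))
        κ-sym e | old o k | old o′ k′ = trans k (trans (c-sym o) (sym k′))

        κ-list : ∀ {u v} → T (E P u v) → κ u v ∈ L u v
        κ-list {u} {v} e with view e
        ... | old o k = subst (_∈ L u v) (sym k) (c-list o)
        ... | new {p} {q} l m k = subst (_∈ L u v) (sym k) (from m (proj₁ (∈-∖⁻ {xs = L (at vs p) (at vs q)} (seen (at vs p) ++ seen (at vs q)) (γ-list (item⁺ l)))))
          where
          from : ∀ {p q x} → Match u v (p , q) → x ∈ L (at vs p) (at vs q) → x ∈ L u v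
          from (inj₁ (refl , refl)) x∈ = x∈
          from (inj₂ (refl , refl)) x∈ = subst (_ ∈_) (sym (proj₁ (long e))) x∈

        meet : ∀ {u v w p q r s f g} → Match u v (p , q) → (p , q) ∈ links C → Match u w (r , s) → (r , s) ∈ links C →
          T (share (it p q f) (it r s g))
        meet {u} {v} {w} {p} {q} {r} {s} m l m′ l′ with link< l | link< l′ | m | m′
        ... | _ , p< , q< | _ , r< , s< | inj₁ (e , _) | inj₁ (e′ , _) =
          ∨-left (≡⇒≡ᵇ p r (at-injective p< r< (trans e (sym e′))))
        ... | _ , p< , q< | _ , r< , s< | inj₁ (e , _) | inj₂ (_ , e′) =
          ∨-right {p ≡ᵇ r} (∨-left (≡⇒≡ᵇ p s (at-injective p< s< (trans e (sym e′)))))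
        ... | _ , p< , q< | _ , r< , s< | inj₂ (_ , e) | inj₁ (e′ , _) =
          ∨-right {p ≡ᵇ r} (∨-right {p ≡ᵇ s} (∨-left (≡⇒≡ᵇ q r (at-injective q< r< (trans e (sym e′))))))
        ... | _ , p< , q< | _ , r< , s< | inj₂ (_ , e) | inj₂ (_ , e′) =
          ∨-right {p ≡ᵇ r} (∨-right {p ≡ᵇ s} (∨-right {q ≡ᵇ r} (≡⇒≡ᵇ q s (at-injective q< s< (trans e (sym e′))))))

        avoids : ∀ {u v w p q} → (p , q) ∈ links C → Match u v (p , q) → T (E smaller u w) → γ p q ≢ c u w
        avoids {u} {w = w} {p} {q} l m o eq = proj₂ (∈-∖⁻ {xs = L (at vs p) (at vs q)} (seen (at vs p) ++ seen (at vs q)) (γ-list (item⁺ l))) (subst (_∈ seen (at vs p) ++ seen (at vs q)) (sym eq) (side m))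
          where
          side : Match u _ (p , q) → c u w ∈ seen (at vs p) ++ seen (at vs q)
          side (inj₁ (refl , _)) = ∈-++⁺ˡ (seen⁺ o)
          side (inj₂ (_ , refl)) = ∈-++⁺ʳ (seen (at vs p)) (seen⁺ o)

        far-end : ∀ {u v w p q} → (p , q) ∈ links C → Match u v (p , q) → Match u w (p , q) → v ≡ w
        far-end l (inj₁ (_ , e)) (inj₁ (_ , e′)) = trans (sym e) e′
        far-end l (inj₂ (e , _)) (inj₂ (e′ , _)) = trans (sym e) e′
        far-end l (inj₁ (refl , e)) (inj₂ (e′ , e″)) with link< l
        ... | lt , p< , q< = ⊥-elim (<-irrefl (at-injective p< q< (sym e″)) lt)
        far-end l (inj₂ (e , refl)) (inj₁ (e′ , e″)) with link< l
        ... | lt , p< , q< = ⊥-elim (<-irrefl (at-injective p< q< e′) lt)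

        κ-proper : ∀ {u v w} → T (E P u v) → T (E P u w) → v ≢ w → κ u v ≢ κ u w
        κ-proper e e′ v≢w eq with view e | view e′
        ... | old o k | old o′ k′ = c-proper o o′ v≢w (trans (sym k) (trans eq k′))
        ... | new l m k | old o k′ = avoids l m o (trans (sym k) (trans eq k′))
        ... | old o k | new l m k′ = avoids l m o (trans (sym k′) (trans (sym eq) k))
        ... | new l m k | new l′ m′ k′ =
          γ-proper (item⁺ l) (item⁺ l′) (meet {f = 0} {g = 0} m l m′ l′)
            (λ { (refl , refl) → v≢w (far-end l m m′) }) (trans (sym k) (trans eq k′))

-- The number 30 is fuel; that it suffices is checked by evaluating the equation.
play : ∀ C → wins 30 (items C) ≡ true → Choosable (items C)
play C w = wins-sound 30 (items C) (subst T (sym w) tt)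

-- The vertices of a configuration are numbered in the order in which they stand on the circle;
-- their letters are those of the corresponding lemma no-… below.  The order of the links only
-- matters for the speed of the game.

pendant : Config
pendant = config (1 ∷ 4 ∷ []) ((0 , 1) ∷ [])

pendant-choosable : Choosable (items pendant)
pendant-choosable = play pendant refl

light : Config
light = config (2 ∷ 3 ∷ []) ((0 , 1) ∷ [])

light-choosable : Choosable (items light)
light-choosable = play light refl

-- Every link has room 2, so this is the fact that the edges of a cycle of length four can be
-- coloured from lists of two colours.
fourCycle : Config
fourCycle = config (4 ∷ 2 ∷ 2 ∷ 4 ∷ []) ((1 , 3) ∷ (0 , 1) ∷ (0 , 2) ∷ (2 , 3) ∷ [])

fourCycle-choosable : Choosable (items fourCycle)
fourCycle-choosable = play fourCycle refl

twoEars : Config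
twoEars = config (4 ∷ 2 ∷ 4 ∷ 2 ∷ 4 ∷ []) ((3 , 4) ∷ (0 , 1) ∷ (1 , 2) ∷ (2 , 3) ∷ (2 , 4) ∷ (0 , 2) ∷ [])

twoEars-choosable : Choosable (items twoEars)
twoEars-choosable = play twoEars refl

k4 : Config
k4 = config (4 ∷ 3 ∷ 3 ∷ 4 ∷ []) ((0 , 3) ∷ (1 , 3) ∷ (1 , 2) ∷ (0 , 1) ∷ (2 , 3) ∷ (0 , 2) ∷ [])

k4-choosable : Choosable (items k4)
k4-choosable = play k4 refl

diamond3 : Config
diamond3 = config (3 ∷ 3 ∷ 3 ∷ 4 ∷ []) ((2 , 3) ∷ (1 , 2) ∷ (0 , 1) ∷ (1 , 3) ∷ (0 , 2) ∷ [])

diamond3-choosable : Choosable (items diamond3)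
diamond3-choosable = play diamond3 refl

earDiamond : Config
earDiamond = config (4 ∷ 2 ∷ 4 ∷ 3 ∷ 3 ∷ 4 ∷ []) ((4 , 5) ∷ (3 , 4) ∷ (0 , 1) ∷ (1 , 2) ∷ (3 , 5) ∷ (2 , 3) ∷ (0 , 2) ∷ (2 , 4) ∷ [])

earDiamond-choosable : Choosable (items earDiamond)
earDiamond-choosable = play earDiamond refl

bypassEar : Config
bypassEar = config (4 ∷ 2 ∷ 4 ∷ 2 ∷ 4 ∷ 4 ∷ []) ((0 , 1) ∷ (1 , 2) ∷ (2 , 3) ∷ (3 , 4) ∷ (4 , 5) ∷ (0 , 4) ∷ (2 , 4) ∷ (2 , 5) ∷ [])

bypassEar-choosable : Choosable (items bypassEar)
bypassEar-choosable = play bypassEar refl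

twoBypassesEar : Config
twoBypassesEar = config (4 ∷ 2 ∷ 4 ∷ 2 ∷ 4 ∷ 2 ∷ 4 ∷ []) ((0 , 1) ∷ (2 , 3) ∷ (4 , 5) ∷ (1 , 2) ∷ (3 , 4) ∷ (2 , 6) ∷ (2 , 4) ∷ (0 , 4) ∷ (5 , 6) ∷ [])

twoBypassesEar-choosable : Choosable (items twoBypassesEar)
twoBypassesEar-choosable = play twoBypassesEar refl

twoEarsBypass : Config
twoEarsBypass = config (4 ∷ 2 ∷ 4 ∷ 2 ∷ 4 ∷ 2 ∷ 4 ∷ []) ((0 , 1) ∷ (2 , 3) ∷ (0 , 4) ∷ (3 , 4) ∷ (4 , 6) ∷ (1 , 2) ∷ (4 , 5) ∷ (0 , 2) ∷ (5 , 6) ∷ (2 , 6) ∷ [])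

twoEarsBypass-choosable : Choosable (items twoEarsBypass)
twoEarsBypass-choosable = play twoEarsBypass refl

sideEar3 : Config
sideEar3 = config (4 ∷ 2 ∷ 4 ∷ 3 ∷ 4 ∷ []) ((3 , 4) ∷ (0 , 3) ∷ (0 , 1) ∷ (1 , 2) ∷ (2 , 3) ∷ (2 , 4) ∷ (0 , 2) ∷ [])

sideEar3-choosable : Choosable (items sideEar3)
sideEar3-choosable = play sideEar3 refl

sideEar2 : Config
sideEar2 = config (4 ∷ 2 ∷ 4 ∷ 2 ∷ 4 ∷ []) ((0 , 3) ∷ (0 , 2) ∷ (1 , 2) ∷ (2 , 4) ∷ (2 , 3) ∷ (0 , 1) ∷ [])

sideEar2-choosable : Choosable (items sideEar2)
sideEar2-choosable = play sideEar2 refl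

sideEars : Config
sideEars = config (4 ∷ 2 ∷ 4 ∷ 4 ∷ 2 ∷ 4 ∷ []) ((2 , 5) ∷ (1 , 2) ∷ (4 , 5) ∷ (3 , 4) ∷ (3 , 5) ∷ (0 , 3) ∷ (0 , 1) ∷ (0 , 2) ∷ (2 , 3) ∷ [])

sideEars-choosable : Choosable (items sideEars)
sideEars-choosable = play sideEars refl

gem3 : Config
gem3 = config (3 ∷ 4 ∷ 2 ∷ 4 ∷ 4 ∷ []) ((0 , 3) ∷ (0 , 1) ∷ (1 , 2) ∷ (2 , 3) ∷ (3 , 4) ∷ (1 , 4) ∷ (1 , 3) ∷ [])

gem3-choosable : Choosable (items gem3)
gem3-choosable = play gem3 refl

earGem : Config
earGem = config (4 ∷ 2 ∷ 4 ∷ 4 ∷ 2 ∷ 4 ∷ 4 ∷ []) ((3 , 6) ∷ (5 , 6) ∷ (3 , 4) ∷ (0 , 1) ∷ (1 , 2) ∷ (4 , 5) ∷ (3 , 5) ∷ (2 , 5) ∷ (2 , 3) ∷ (0 , 2) ∷ [])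

earGem-choosable : Choosable (items earGem)
earGem-choosable = play earGem refl

closedGem3 : Config
closedGem3 = config (3 ∷ 4 ∷ 2 ∷ 4 ∷ 4 ∷ []) ((0 , 4) ∷ (2 , 3) ∷ (1 , 4) ∷ (1 , 2) ∷ (0 , 1) ∷ (3 , 4) ∷ (0 , 3) ∷ (1 , 3) ∷ [])

closedGem3-choosable : Choosable (items closedGem3)
closedGem3-choosable = play closedGem3 refl

gemLight : Config
gemLight = config (3 ∷ 4 ∷ 4 ∷ 2 ∷ 4 ∷ 4 ∷ []) ((4 , 5) ∷ (0 , 1) ∷ (2 , 3) ∷ (3 , 4) ∷ (1 , 5) ∷ (1 , 2) ∷ (2 , 4) ∷ (2 , 5) ∷ (1 , 4) ∷ [])

gemLight-choosable : Choosable (items gemLight)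
gemLight-choosable = play gemLight refl

gemApex : Config
gemApex = config (4 ∷ 4 ∷ 4 ∷ 2 ∷ 4 ∷ 4 ∷ []) ((2 , 5) ∷ (3 , 4) ∷ (0 , 1) ∷ (2 , 3) ∷ (1 , 5) ∷ (1 , 2) ∷ (0 , 5) ∷ (4 , 5) ∷ (1 , 4) ∷ (2 , 4) ∷ [])

gemApex-choosable : Choosable (items gemApex)
gemApex-choosable = play gemApex refl

-- Moves by hand for one large configuration

FitsItem : Lists → Item → Set
FitsItem L (it p q f) = Unique (L p q) × f ≤ length (L p q)

MissingFrom : Lists → ℕ → Item → Set
MissingFrom L k (it p q _) = k ∉ L p q

-- The size 0 is a dummy, since `share` looks at the ends only.
erase : Item → ℕ → Lists → Lists
erase x k L r s = if share x (it r s 0) then L r s ∖ (k ∷ []) else L r s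

-- `spared` holds neighbours whose lists are known to lack the colour being used; they are
-- recognised by their ends.
charge : Item → List Item → Item → Item
charge x spared y@(it r s f) = if share x y then (if named r s spared then y else it r s (f ∸ 1)) else y

module _ {L : Lists} {p q : ℕ} (k : ℕ) where

  erase-⊆ : ∀ r s {j} → j ∈ erase (it p q 0) k L r s → j ∈ L r s
  erase-⊆ r s j∈ with share (it p q 0) (it r s 0)
  ... | true = proj₁ (∈-∖⁻ {xs = L r s} (k ∷ []) j∈)
  ... | false = j∈

  erase-∉ : ∀ r s → T (share (it p q 0) (it r s 0)) → k ∉ erase (it p q 0) k L r s
  erase-∉ r s t k∈ with share (it p q 0) (it r s 0)
  ... | true = proj₂ (∈-∖⁻ {xs = L r s} (k ∷ []) k∈) (here refl)

  erase-fits : ∀ spared → All (MissingFrom L k) spared → ∀ y → FitsItem L y →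
    FitsItem (erase (it p q 0) k L) (charge (it p q 0) spared y)
  erase-fits spared miss (it r s f) (u , le) with share (it p q 0) (it r s 0) in sh
  ... | false = subst (λ b → Unique (if b then L r s ∖ (k ∷ []) else L r s) × f ≤ length (if b then L r s ∖ (k ∷ []) else L r s)) (sym sh) (u , le)
  ... | true with named r s spared in nm
  ...   | false = subst (λ b → Unique (if b then L r s ∖ (k ∷ []) else L r s) × f ∸ 1 ≤ length (if b then L r s ∖ (k ∷ []) else L r s)) (sym sh)
            (∖-unique (k ∷ []) u , ∸-monoˡ-≤ 1 (≤-trans le (length-∖ u (k ∷ []))))
  ...   | true = subst (λ b → Unique (if b then L r s ∖ (k ∷ []) else L r s) × f ≤ length (if b then L r s ∖ (k ∷ []) else L r s)) (sym sh)
            (∖-unique (k ∷ []) u , subst (λ xs → f ≤ length xs) (sym (∖-disjoint (k ∷ []) k∉)) le)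
    where
    k∉ : ∀ {j} → j ∈ L r s → j ∉ k ∷ []
    k∉ j∈ (here refl) with named⁻ spared (subst T (sym nm) tt)
    ... | g , m = All.lookup miss m j∈

charge-id : ∀ x spared {r s f} → ∃[ g ] charge x spared (it r s f) ≡ it r s g
charge-id x spared {r} {s} {f} with share x (it r s f)
... | false = f , refl
... | true with named r s spared
...   | true = f , refl
...   | false = f ∸ 1 , refl

-- The first item gets k, which costs each of its neighbours a colour, except the spared ones.
spend : ∀ {L p q f st} k spared → k ∈ L p q → All (MissingFrom L k) spared → All (FitsItem L) st →
  (∀ {st′} → st′ ≡ map (charge (it p q 0) spared) st → All (FitsItem (erase (it p q 0) k L)) st′ →
    ∃ (Colours (erase (it p q 0) k L) st′)) →
  ∃ (Colours L (it p q f ∷ st))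
spend {L} {p} {q} {f} {st} k spared k∈ miss fits next with next refl (charged fits)
  where
  charged : ∀ {st} → All (FitsItem L) st → All (FitsItem (erase (it p q 0) k L)) (map (charge (it p q 0) spared) st)
  charged [] = []
  charged {y ∷ _} (fy ∷ fs) = erase-fits k spared miss y fy ∷ charged fs
... | c , inL , proper = recolour I k c , member , distinct
  where
  I = it p q f ∷ []
  moved : ∀ {r s g} → it r s g ∈ st → ∃[ h ] it r s h ∈ map (charge (it p q 0) spared) st
  moved {r} {s} {g} m with charge-id (it p q 0) spared {r} {s} {g}
  ... | h , e = h , subst (_∈ map (charge (it p q 0) spared) st) e (∈-map⁺ (charge (it p q 0) spared) m)
  member : ∀ {r s g} → it r s g ∈ it p q f ∷ st → recolour I k c r s ∈ L r s
  member {r} {s} m with recolour-cases I k c r s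
  ... | inj₁ ((_ , here refl) , e) = subst (_∈ L r s) (sym e) k∈
  member (here refl) | inj₂ (n , e) = ⊥-elim (n (here refl))
  member {r} {s} (there m) | inj₂ (n , e) = subst (_∈ L r s) (sym e) (erase-⊆ {L} {p} {q} k r s (inL (proj₂ (moved m))))
  distinct : ∀ {r s g t u h} → it r s g ∈ it p q f ∷ st → it t u h ∈ it p q f ∷ st →
    T (share (it r s g) (it t u h)) → ¬ (r ≡ t × s ≡ u) → recolour I k c r s ≢ recolour I k c t u
  distinct {r} {s} {g} {t} {u} {h} m m′ sh ne eq with recolour-cases I k c r s | recolour-cases I k c t u
  ... | inj₁ ((_ , here refl) , _) | inj₁ ((_ , here refl) , _) = ne (refl , refl)
  distinct m (here refl) sh ne eq | _ | inj₂ (n , _) = n (here refl)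
  distinct (here refl) m′ sh ne eq | inj₂ (n , _) | _ = n (here refl)
  distinct {t = t} {u} m (there m′) sh ne eq | inj₁ ((_ , here refl) , e) | inj₂ (n , e′) =
    erase-∉ {L} {p} {q} k t u sh (subst (_∈ erase (it p q 0) k L t u) (sym (trans (sym e) (trans eq e′))) (inL (proj₂ (moved m′))))
  distinct {r} {s} {g} (there m) m′ sh ne eq | inj₂ (n , e) | inj₁ ((_ , here refl) , e′) =
    erase-∉ {L} {p} {q} k r s (share-sym (it r s g) (it p q f) sh) (subst (_∈ erase (it p q 0) k L r s) (trans (sym e) (trans eq e′)) (inL (proj₂ (moved m))))
  distinct (there m) (there m′) sh ne eq | inj₂ (n , e) | inj₂ (n′ , e′) =
    proper (proj₂ (moved m)) (proj₂ (moved m′)) sh ne (trans (sym e) (trans eq e′))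

some : ∀ {f} (xs : List ℕ) → Unique xs × suc f ≤ length xs → ∃[ k ] k ∈ xs
some xs (u , le) with pick u [] (≤-trans (s≤s z≤n) le)
... | k , k∈ , _ = k , k∈

finish : ∀ st → wins 30 st ≡ true → ∀ {L} → All (FitsItem L) st → ∃ (Colours L st)
finish st w fits = wins-sound 30 st (subst T (sym w) tt) _ (All.lookup fits)

-- This configuration is too large for the game to be decided quickly; its first moves are made
-- by hand, after cutting down the lists of xy and uy to two colours.
earsGem : Config
earsGem = config (4 ∷ 2 ∷ 4 ∷ 4 ∷ 4 ∷ 2 ∷ 4 ∷ 4 ∷ 4 ∷ [])
  ((2 , 8) ∷ (7 , 8) ∷ (0 , 2) ∷ (0 , 1) ∷ (1 , 2) ∷ (2 , 3) ∷
   (6 , 7) ∷ (4 , 5) ∷ (5 , 6) ∷ (3 , 7) ∷ (4 , 7) ∷ (3 , 6) ∷ (3 , 4) ∷ (4 , 6) ∷ [])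

private
  swapped : ∀ {P : Item → Set} {a b c d e xs} → All P (a ∷ b ∷ c ∷ d ∷ e ∷ xs) → All P (a ∷ b ∷ e ∷ c ∷ d ∷ xs)
  swapped (a ∷ b ∷ c ∷ d ∷ e ∷ xs) = a ∷ b ∷ e ∷ c ∷ d ∷ xs

  swapped-∈ : ∀ {x a b c d e : Item} {xs} → x ∈ a ∷ b ∷ c ∷ d ∷ e ∷ xs → x ∈ a ∷ b ∷ e ∷ c ∷ d ∷ xs
  swapped-∈ (here e) = here e
  swapped-∈ (there (here e)) = there (here e)
  swapped-∈ (there (there (here e))) = there (there (there (here e)))
  swapped-∈ (there (there (there (here e)))) = there (there (there (there (here e))))
  swapped-∈ (there (there (there (there (here e))))) = there (there (here e))
  swapped-∈ (there (there (there (there (there m))))) = there (there (there (there (there m))))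

  ∉-∖ : ∀ {k} xs → k ∉ xs ∖ (k ∷ [])
  ∉-∖ {k} xs k∈ = proj₂ (∈-∖⁻ {xs = xs} (k ∷ []) k∈) (here refl)

  ∉-∖-mono : ∀ {k} xs ys → k ∉ xs → k ∉ xs ∖ ys
  ∉-∖-mono xs ys k∉ k∈ = k∉ (proj₁ (∈-∖⁻ {xs = xs} ys k∈))

module _ {L : Lists} where

  private
    Goal = All (FitsItem L) (items earsGem) → ∃ (Colours L (items earsGem))

    -- The vertices 0 to 8 are y, u, x, a, b, w, c, d, z. A colour common to xz and uy is used on
    -- both, so that ux, which meets both, loses one colour instead of two.
    common : ∀ {p} → p ∈ L 2 8 → p ∈ L 0 1 → Goal
    common {p} p∈xz p∈uy (_ ∷ rest) =
      spend p [] p∈xz [] rest λ { refl (dz ∷ rest₁) →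
      let k , k∈ = some (L 7 8 ∖ (p ∷ [])) dz in spend k [] k∈ [] rest₁ λ { refl (xy ∷ rest₂) →
      let j , j∈ = some (L 0 2 ∖ (p ∷ [])) xy in spend j [] j∈ [] rest₂ λ { refl (uy ∷ rest₃) →
      spend p (it 1 2 0 ∷ []) (∈-∖⁺ {xs = L 0 1} (j ∷ []) p∈uy λ { (here e) → ∉-∖ (L 0 2) (subst (_∈ L 0 2 ∖ (p ∷ [])) (sym e) j∈) })
        (∉-∖-mono (L 1 2 ∖ (p ∷ [])) (j ∷ []) (∉-∖ (L 1 2)) ∷ []) rest₃ λ { refl rest₄ →
      finish _ refl rest₄ } } } }

    -- A colour that xy has and uy lacks goes to xy, so uy keeps both of its colours.
    private-colour : ∀ {p k} → p ∈ L 2 8 → k ∈ L 0 2 → k ≢ p → k ∉ L 0 1 → Goal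
    private-colour {p} {k} p∈xz k∈xy k≢p k∉uy (_ ∷ rest) =
      spend p [] p∈xz [] rest λ { refl (dz ∷ rest₁) →
      let j , j∈ = some (L 7 8 ∖ (p ∷ [])) dz in spend j [] j∈ [] rest₁ λ { refl (xy ∷ rest₂) →
      spend k (it 0 1 0 ∷ []) (∈-∖⁺ (p ∷ []) k∈xy λ { (here e) → k≢p e }) (k∉uy ∷ []) rest₂ λ { refl rest₃ →
      finish _ refl rest₃ } } }

    -- The three colours that xz leaves to ux include one outside the two colours of xy, hence also
    -- outside those of uy. Giving it to ux costs neither of them anything, and `p` costs xy
    -- nothing. For this ux has to be coloured before xy, whence the reordering.
    third-colour : ∀ {p} → p ∈ L 2 8 → p ∉ L 0 2 → (∀ {k} → k ∉ L 0 2 → k ∉ L 0 1) → length (L 0 2) ≡ 2 → Goal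
    third-colour {p} p∈xz p∉xy xy⊆uy two fits with swapped fits
    ... | _ ∷ rest with (spend p (it 0 2 0 ∷ []) p∈xz (p∉xy ∷ []) rest λ { refl (dz ∷ rest₁) →
          let j , j∈ = some (L 7 8 ∖ (p ∷ [])) dz in spend j [] j∈ [] rest₁ λ { refl (xu ∷ rest₂) →
          let t , t∈ , t∉ = pick (proj₁ xu) (L 0 2) (subst (_< length (L 1 2 ∖ (p ∷ []))) (sym two) (proj₂ xu)) in
          spend t (it 0 2 0 ∷ it 0 1 0 ∷ []) t∈ (∉-∖-mono (L 0 2) (p ∷ []) t∉ ∷ xy⊆uy t∉ ∷ []) rest₂ λ { refl rest₃ →
          finish _ refl rest₃ } } })
    ...   | c , inL , proper = c , inL ∘ swapped-∈ , λ m m′ → proper (swapped-∈ m) (swapped-∈ m′)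

  -- Exact lengths serve the last case: if all colours of xy are colours of uy, then by counting the
  -- two lists have the same colours.
  earsGem-exact : length (L 0 2) ≡ 2 → length (L 0 1) ≡ 2 → Goal
  earsGem-exact two two′ fits@((uxz , two≤) ∷ _ ∷ (uxy , _) ∷ (uuy , _) ∷ _)
    with pick uxz [] (≤-trans (s≤s z≤n) two≤)
  ... | p , p∈xz , _ with p ∈? L 0 1
  ...   | yes p∈uy = common p∈xz p∈uy fits
  ...   | no p∉uy with L 0 2 ∖ L 0 1 in eq
  ...     | k ∷ _ with ∈-∖⁻ {xs = L 0 2} (L 0 1) (subst (k ∈_) (sym eq) (here refl))
                     | pick uxz (k ∷ []) two≤
  -- The colour of xz is chosen anew, different from `k`, in order to keep `k` for xy.
  ...       | k∈xy , k∉uy | q , q∈xz , q∉k = private-colour q∈xz k∈xy (λ e → q∉k (here (sym e))) k∉uy fits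
  earsGem-exact two two′ fits@(_ ∷ _ ∷ (uxy , _) ∷ _) | p , p∈xz , _ | no p∉uy | [] =
    third-colour p∈xz (p∉uy ∘ sub) sup two fits
    where
    sub : ∀ {j} → j ∈ L 0 2 → j ∈ L 0 1
    sub {j} j∈ with j ∈? L 0 1
    ... | yes j∈′ = j∈′
    ... | no j∉ with subst (j ∈_) eq (∈-∖⁺ (L 0 1) j∈ j∉)
    ...   | ()
    sup : ∀ {j} → j ∉ L 0 2 → j ∉ L 0 1
    sup {j} j∉ j∈ = <⇒≱ (n<1+n 2) (subst₂ _≤_ (cong suc two) two′
      (length-⊆ (All.tabulate (λ m e → j∉ (subst (_∈ L 0 2) (sym e) m)) ∷ uxy) λ { (here refl) → j∈ ; (there m) → sub m }))

∈-take⁻ : ∀ n {xs} {k : ℕ} → k ∈ take n xs → k ∈ xs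
∈-take⁻ (suc n) {_ ∷ _} (here e) = here e
∈-take⁻ (suc n) {_ ∷ _} (there m) = there (∈-take⁻ n m)

earsGem-choosable : Choosable (items earsGem)
earsGem-choosable L fits = uncut (earsGem-exact {L′} (cut-length {L 0 2} (proj₂ (fits (there (there (here refl))))))
    (cut-length {L 0 1} (proj₂ (fits (there (there (there (here refl))))))) (cut (All.tabulate {P = FitsItem L} (λ { {it _ _ _} → fits }))))
  where
  L′ : Lists
  -- Among the links exactly xy and uy start at 0.
  L′ p q = if p ≡ᵇ 0 then take 2 (L p q) else L p q
  cut-length : ∀ {xs : List ℕ} → 2 ≤ length xs → length (take 2 xs) ≡ 2
  cut-length {xs} le = trans (length-take 2 xs) (m≤n⇒m⊓n≡m le)
  cut-fits : ∀ {xs : List ℕ} → Unique xs × 2 ≤ length xs → Unique (take 2 xs) × 2 ≤ length (take 2 xs)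
  cut-fits {xs} (u , le) = Unique.take⁺ 2 u , ≤-reflexive (sym (cut-length {xs} le))
  cut : All (FitsItem L) (items earsGem) → All (FitsItem L′) (items earsGem)
  cut (a ∷ b ∷ c ∷ d ∷ e ∷ f ∷ g ∷ h ∷ i ∷ j ∷ k ∷ l ∷ m ∷ n ∷ []) =
    a ∷ b ∷ cut-fits {L 0 2} c ∷ cut-fits {L 0 1} d ∷ e ∷ f ∷ g ∷ h ∷ i ∷ j ∷ k ∷ l ∷ m ∷ n ∷ []
  L′⊆L : ∀ p q {k} → k ∈ L′ p q → k ∈ L p q
  L′⊆L zero q = ∈-take⁻ 2
  L′⊆L (suc p) q k∈ = k∈
  uncut : ∃ (Colours L′ (items earsGem)) → ∃ (Colours L (items earsGem))
  uncut (c , inL , proper) = c , (λ {p} {q} m → L′⊆L p q (inL m)) , proper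

-- The structure of a critical graph

module Shapes {n} (P : Plane n) where

  infix 4 _~_
  _~_ : ℕ → ℕ → Set
  u ~ v = T (E P u v)

  module _ (_≺_ : ℕ → ℕ → Set) where

    Closed : ℕ → ℕ → Set
    Closed i j = ∀ {x y} → i ≺ x → x ≺ j → x ~ y → ¬ (y ≺ i) × ¬ (j ≺ y)

    -- Upper bounds for the neighbours of an end inside the interval; where two intervals meet, they
    -- combine to a bound for the degree of the common end.
    LeftNbrs RightNbrs : ℕ → ℕ → List ℕ → Set
    LeftNbrs  i j xs = ∀ {x} → i ≺ x → x ≺ j → i ~ x → x ∈ xs
    RightNbrs i j xs = ∀ {x} → i ≺ x → x ≺ j → j ~ x → x ∈ xs

    -- The crossing of ac and bd, with the 2-vertex w adjacent to b and c.
    record Gem (a b w c d : ℕ) : Set where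
      constructor mkGem
      field
        order : Linked _≺_ (a ∷ b ∷ w ∷ c ∷ d ∷ [])
        ab : a ~ b
        ac : a ~ c
        bd : b ~ d
        cd : c ~ d
        bc : b ~ c
        bw : b ~ w
        wc : w ~ c
        δw : degree P w ≤ 2

    -- What the part of a critical graph between i and j looks like when no edge leaves it
    -- except at i and j.
    data Shape (i j : ℕ) : Set where
      empty : (∀ {x y} → i ≺ x → x ≺ j → ¬ x ~ y) → Shape i j
      ear : ∀ {w} → i ≺ w → w ≺ j → i ~ w → w ~ j → degree P w ≤ 2 →
        LeftNbrs i j (w ∷ []) → RightNbrs i j (w ∷ []) → Shape i j
      diamond : ∀ {b c} → i ≺ b → b ≺ c → c ≺ j → i ~ b → i ~ c → b ~ c → b ~ j → c ~ j →
        degree P b ≤ 3 → degree P c ≤ 3 → ¬ i ~ j →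
        LeftNbrs i j (b ∷ c ∷ []) → RightNbrs i j (b ∷ c ∷ []) → Shape i j
      gem : ∀ {b w c} → Gem i b w c j → ¬ i ~ j →
        LeftNbrs i j (b ∷ c ∷ []) → RightNbrs i j (b ∷ c ∷ []) → Shape i j
      closedGem : ∀ {b w c} → Gem i b w c j → i ~ j →
        LeftNbrs i j (b ∷ c ∷ []) → RightNbrs i j (b ∷ c ∷ []) → Shape i j
      gemEdge : ∀ {b w c d} → Gem i b w c d → i ~ d → d ≺ j → d ~ j → ¬ i ~ j →
        LeftNbrs i j (b ∷ c ∷ d ∷ []) → RightNbrs i j (d ∷ []) → Shape i j
      edgeGem : ∀ {a b w c} → i ≺ a → i ~ a → Gem a b w c j → a ~ j → ¬ i ~ j →
        LeftNbrs i j (a ∷ []) → RightNbrs i j (b ∷ c ∷ a ∷ []) → Shape i j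
      edgeGemEdge : ∀ {a b w c d} → i ≺ a → i ~ a → Gem a b w c d → a ~ d → d ≺ j → d ~ j →
        LeftNbrs i j (a ∷ []) → RightNbrs i j (d ∷ []) → Shape i j

  module _ {_≺_ : ℕ → ℕ → Set} where

    private
      _≻_ : ℕ → ℕ → Set
      x ≻ y = y ≺ x

      s : ∀ {u v} → u ~ v → v ~ u
      s = E-sym P

      swap₂ : ∀ {b c x : ℕ} → x ∈ b ∷ c ∷ [] → x ∈ c ∷ b ∷ []
      swap₂ (here e) = there (here e)
      swap₂ (there (here e)) = here e

      swap₃ : ∀ {b c d x : ℕ} → x ∈ b ∷ c ∷ d ∷ [] → x ∈ c ∷ b ∷ d ∷ []
      swap₃ (here e) = there (here e)
      swap₃ (there (here e)) = here e
      swap₃ (there (there m)) = there (there m)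

    flipGem : ∀ {a b w c d} → Gem _≺_ a b w c d → Gem _≻_ d c w b a
    flipGem (mkGem (p ∷ q ∷ r ∷ t ∷ [-]) ab ac bd cd bc bw wc δw) =
      mkGem (t ∷ r ∷ q ∷ p ∷ [-]) (s cd) (s bd) (s ac) (s ab) (s bc) (s wc) (s bw) δw

    flipShape : ∀ {i j} → Shape _≺_ i j → Shape _≻_ j i
    flipShape (empty t) = empty λ p q → t q p
    flipShape (ear p q e f δ l r) = ear q p (s f) (s e) δ (λ p q → r q p) (λ p q → l q p)
    flipShape (diamond p q t ib ic bc bj cj δb δc ne l r) =
      diamond t q p (s cj) (s bj) (s bc) (s ic) (s ib) δc δb (ne ∘ s) (λ p q → swap₂ ∘ r q p) (λ p q → swap₂ ∘ l q p)
    flipShape (gem g ne l r) = gem (flipGem g) (ne ∘ s) (λ p q → swap₂ ∘ r q p) (λ p q → swap₂ ∘ l q p)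
    flipShape (closedGem g e l r) = closedGem (flipGem g) (s e) (λ p q → swap₂ ∘ r q p) (λ p q → swap₂ ∘ l q p)
    flipShape (gemEdge g e p f ne l r) =
      edgeGem p (s f) (flipGem g) (s e) (ne ∘ s) (λ p q → r q p) (λ p q → swap₃ ∘ l q p)
    flipShape (edgeGem p f g e ne l r) =
      gemEdge (flipGem g) (s e) p (s f) (ne ∘ s) (λ p q → swap₃ ∘ r q p) (λ p q → l q p)
    flipShape (edgeGemEdge p e g f q h l r) =
      edgeGemEdge q (s h) (flipGem g) (s f) p (s e) (λ p q → r q p) (λ p q → l q p)

-- The order is < or >, so that each lemma comes with its mirror image.
module Ordered {n} {P : Plane n} {L : Lists} (crit : Critical P L)
  {_≺_ : ℕ → ℕ → Set} (isSTO : IsStrictTotalOrder _≡_ _≺_) where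

  open IsStrictTotalOrder isSTO using (compare; irrefl) renaming (trans to ≺-trans)
  open Shapes P

  distinct : ∀ {vs} → Linked _≺_ vs → Unique vs
  distinct o = AllPairs.map (λ lt e → irrefl e lt) (Linked⇒AllPairs ≺-trans o)

  ends : ∀ {u v} → u ~ v → Unique (u ∷ v ∷ [])
  ends uv = ((λ { refl → E-irr P uv }) ∷ []) ∷ [] ∷ []

  no-pendant : ∀ {u v} → u ~ v → degree P u ≤ 1 → ⊥
  no-pendant uv δu = reduce crit pendant pendant-choosable (toWitness {a? = valid? pendant} tt) (ends uv)
    (uv ∷ []) (δu ∷ deg≤4 P _ ∷ [])

  no-light : ∀ {u v} → u ~ v → degree P u ≤ 2 → degree P v ≤ 3 → ⊥
  no-light uv δu δv = reduce crit light light-choosable (toWitness {a? = valid? light} tt) (ends uv)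
    (uv ∷ []) (δu ∷ δv ∷ [])

  no-fourCycle : ∀ {a b c d} → Linked _≺_ (a ∷ b ∷ c ∷ d ∷ []) →
    a ~ b → a ~ c → b ~ d → c ~ d → degree P b ≤ 2 → degree P c ≤ 2 → ⊥
  no-fourCycle o ab ac bd cd δb δc = reduce crit fourCycle fourCycle-choosable (toWitness {a? = valid? fourCycle} tt) (distinct o)
    (bd ∷ ab ∷ ac ∷ cd ∷ []) (deg≤4 P _ ∷ δb ∷ δc ∷ deg≤4 P _ ∷ [])

  no-twoEars : ∀ {y u x v z} → Linked _≺_ (y ∷ u ∷ x ∷ v ∷ z ∷ []) →
    y ~ u → y ~ x → u ~ x → x ~ v → x ~ z → v ~ z → degree P u ≤ 2 → degree P v ≤ 2 → ⊥
  no-twoEars o yu yx ux xv xz vz δu δv = reduce crit twoEars twoEars-choosable (toWitness {a? = valid? twoEars} tt) (distinct o)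
    (vz ∷ yu ∷ ux ∷ xv ∷ xz ∷ yx ∷ []) (deg≤4 P _ ∷ δu ∷ deg≤4 P _ ∷ δv ∷ deg≤4 P _ ∷ [])

  no-k4 : ∀ {a b c d} → Linked _≺_ (a ∷ b ∷ c ∷ d ∷ []) →
    a ~ b → a ~ c → a ~ d → b ~ c → b ~ d → c ~ d → degree P b ≤ 3 → degree P c ≤ 3 → ⊥
  no-k4 o ab ac ad bc bd cd δb δc = reduce crit k4 k4-choosable (toWitness {a? = valid? k4} tt) (distinct o)
    (ad ∷ bd ∷ bc ∷ ab ∷ cd ∷ ac ∷ []) (deg≤4 P _ ∷ δb ∷ δc ∷ deg≤4 P _ ∷ [])

  no-diamond3 : ∀ {a b c d} → Linked _≺_ (a ∷ b ∷ c ∷ d ∷ []) →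
    a ~ b → a ~ c → b ~ c → b ~ d → c ~ d → degree P a ≤ 3 → degree P b ≤ 3 → degree P c ≤ 3 → ⊥
  no-diamond3 o ab ac bc bd cd δa δb δc = reduce crit diamond3 diamond3-choosable (toWitness {a? = valid? diamond3} tt) (distinct o)
    (cd ∷ bc ∷ ab ∷ bd ∷ ac ∷ []) (δa ∷ δb ∷ δc ∷ deg≤4 P _ ∷ [])

  no-earDiamond : ∀ {y u a b c d} → Linked _≺_ (y ∷ u ∷ a ∷ b ∷ c ∷ d ∷ []) →
    y ~ u → y ~ a → u ~ a → a ~ b → a ~ c → b ~ c → b ~ d → c ~ d → degree P u ≤ 2 → degree P b ≤ 3 → degree P c ≤ 3 → ⊥
  no-earDiamond o yu ya ua ab ac bc bd cd δu δb δc = reduce crit earDiamond earDiamond-choosable (toWitness {a? = valid? earDiamond} tt) (distinct o)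
    (cd ∷ bc ∷ yu ∷ ua ∷ bd ∷ ab ∷ ya ∷ ac ∷ []) (deg≤4 P _ ∷ δu ∷ deg≤4 P _ ∷ δb ∷ δc ∷ deg≤4 P _ ∷ [])

  no-bypassEar : ∀ {a x b w c d} → Linked _≺_ (a ∷ x ∷ b ∷ w ∷ c ∷ d ∷ []) →
    a ~ x → a ~ c → x ~ b → b ~ w → b ~ c → b ~ d → w ~ c → c ~ d → degree P x ≤ 2 → degree P w ≤ 2 → ⊥
  no-bypassEar o ax ac xb bw bc bd wc cd δx δw = reduce crit bypassEar bypassEar-choosable (toWitness {a? = valid? bypassEar} tt) (distinct o)
    (ax ∷ xb ∷ bw ∷ wc ∷ cd ∷ ac ∷ bc ∷ bd ∷ []) (deg≤4 P _ ∷ δx ∷ deg≤4 P _ ∷ δw ∷ deg≤4 P _ ∷ deg≤4 P _ ∷ [])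

  no-twoBypassesEar : ∀ {a x b w c y d} → Linked _≺_ (a ∷ x ∷ b ∷ w ∷ c ∷ y ∷ d ∷ []) →
    a ~ x → a ~ c → x ~ b → b ~ w → b ~ c → b ~ d → w ~ c → c ~ y → y ~ d → degree P x ≤ 2 → degree P w ≤ 2 → degree P y ≤ 2 → ⊥
  no-twoBypassesEar o ax ac xb bw bc bd wc cy yd δx δw δy = reduce crit twoBypassesEar twoBypassesEar-choosable (toWitness {a? = valid? twoBypassesEar} tt) (distinct o)
    (ax ∷ bw ∷ cy ∷ xb ∷ wc ∷ bd ∷ bc ∷ ac ∷ yd ∷ []) (deg≤4 P _ ∷ δx ∷ deg≤4 P _ ∷ δw ∷ deg≤4 P _ ∷ δy ∷ deg≤4 P _ ∷ [])

  no-twoEarsBypass : ∀ {a u b w c v d} → Linked _≺_ (a ∷ u ∷ b ∷ w ∷ c ∷ v ∷ d ∷ []) →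
    a ~ u → a ~ b → a ~ c → u ~ b → b ~ w → b ~ d → w ~ c → c ~ v → c ~ d → v ~ d → degree P u ≤ 2 → degree P w ≤ 2 → degree P v ≤ 2 → ⊥
  no-twoEarsBypass o au ab ac ub bw bd wc cv cd vd δu δw δv = reduce crit twoEarsBypass twoEarsBypass-choosable (toWitness {a? = valid? twoEarsBypass} tt) (distinct o)
    (au ∷ bw ∷ ac ∷ wc ∷ cd ∷ ub ∷ cv ∷ ab ∷ vd ∷ bd ∷ []) (deg≤4 P _ ∷ δu ∷ deg≤4 P _ ∷ δw ∷ deg≤4 P _ ∷ δv ∷ deg≤4 P _ ∷ [])

  no-sideEar3 : ∀ {a u b c d} → Linked _≺_ (a ∷ u ∷ b ∷ c ∷ d ∷ []) →
    a ~ u → a ~ b → a ~ c → u ~ b → b ~ c → b ~ d → c ~ d → degree P u ≤ 2 → degree P c ≤ 3 → ⊥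
  no-sideEar3 o au ab ac ub bc bd cd δu δc = reduce crit sideEar3 sideEar3-choosable (toWitness {a? = valid? sideEar3} tt) (distinct o)
    (cd ∷ ac ∷ au ∷ ub ∷ bc ∷ bd ∷ ab ∷ []) (deg≤4 P _ ∷ δu ∷ deg≤4 P _ ∷ δc ∷ deg≤4 P _ ∷ [])

  no-sideEar2 : ∀ {a u b c d} → Linked _≺_ (a ∷ u ∷ b ∷ c ∷ d ∷ []) →
    a ~ u → a ~ b → a ~ c → u ~ b → b ~ c → b ~ d → degree P u ≤ 2 → degree P c ≤ 2 → ⊥
  no-sideEar2 o au ab ac ub bc bd δu δc = reduce crit sideEar2 sideEar2-choosable (toWitness {a? = valid? sideEar2} tt) (distinct o)
    (ac ∷ ab ∷ ub ∷ bd ∷ bc ∷ au ∷ []) (deg≤4 P _ ∷ δu ∷ deg≤4 P _ ∷ δc ∷ deg≤4 P _ ∷ [])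

  no-sideEars : ∀ {a u b c v d} → Linked _≺_ (a ∷ u ∷ b ∷ c ∷ v ∷ d ∷ []) →
    a ~ u → a ~ b → a ~ c → u ~ b → b ~ c → b ~ d → c ~ v → c ~ d → v ~ d → degree P u ≤ 2 → degree P v ≤ 2 → ⊥
  no-sideEars o au ab ac ub bc bd cv cd vd δu δv = reduce crit sideEars sideEars-choosable (toWitness {a? = valid? sideEars} tt) (distinct o)
    (bd ∷ ub ∷ vd ∷ cv ∷ cd ∷ ac ∷ au ∷ ab ∷ bc ∷ []) (deg≤4 P _ ∷ δu ∷ deg≤4 P _ ∷ deg≤4 P _ ∷ δv ∷ deg≤4 P _ ∷ [])

  no-gem3 : ∀ {a b w c d} → Linked _≺_ (a ∷ b ∷ w ∷ c ∷ d ∷ []) →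
    a ~ b → a ~ c → b ~ w → b ~ c → b ~ d → w ~ c → c ~ d → degree P a ≤ 3 → degree P w ≤ 2 → ⊥
  no-gem3 o ab ac bw bc bd wc cd δa δw = reduce crit gem3 gem3-choosable (toWitness {a? = valid? gem3} tt) (distinct o)
    (ac ∷ ab ∷ bw ∷ wc ∷ cd ∷ bd ∷ bc ∷ []) (δa ∷ deg≤4 P _ ∷ δw ∷ deg≤4 P _ ∷ deg≤4 P _ ∷ [])

  no-earGem : ∀ {y u a b w c d} → Linked _≺_ (y ∷ u ∷ a ∷ b ∷ w ∷ c ∷ d ∷ []) →
    y ~ u → y ~ a → u ~ a → a ~ b → a ~ c → b ~ w → b ~ c → b ~ d → w ~ c → c ~ d → degree P u ≤ 2 → degree P w ≤ 2 → ⊥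
  no-earGem o yu ya ua ab ac bw bc bd wc cd δu δw = reduce crit earGem earGem-choosable (toWitness {a? = valid? earGem} tt) (distinct o)
    (bd ∷ cd ∷ bw ∷ yu ∷ ua ∷ wc ∷ bc ∷ ac ∷ ab ∷ ya ∷ []) (deg≤4 P _ ∷ δu ∷ deg≤4 P _ ∷ deg≤4 P _ ∷ δw ∷ deg≤4 P _ ∷ deg≤4 P _ ∷ [])

  no-closedGem3 : ∀ {a b w c d} → Linked _≺_ (a ∷ b ∷ w ∷ c ∷ d ∷ []) →
    a ~ b → a ~ c → a ~ d → b ~ w → b ~ c → b ~ d → w ~ c → c ~ d → degree P a ≤ 3 → degree P w ≤ 2 → ⊥
  no-closedGem3 o ab ac ad bw bc bd wc cd δa δw = reduce crit closedGem3 closedGem3-choosable (toWitness {a? = valid? closedGem3} tt) (distinct o)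
    (ad ∷ wc ∷ bd ∷ bw ∷ ab ∷ cd ∷ ac ∷ bc ∷ []) (δa ∷ deg≤4 P _ ∷ δw ∷ deg≤4 P _ ∷ deg≤4 P _ ∷ [])

  no-gemLight : ∀ {z a b w c d} → Linked _≺_ (z ∷ a ∷ b ∷ w ∷ c ∷ d ∷ []) →
    z ~ a → a ~ b → a ~ c → a ~ d → b ~ w → b ~ c → b ~ d → w ~ c → c ~ d → degree P z ≤ 3 → degree P w ≤ 2 → ⊥
  no-gemLight o za ab ac ad bw bc bd wc cd δz δw = reduce crit gemLight gemLight-choosable (toWitness {a? = valid? gemLight} tt) (distinct o)
    (cd ∷ za ∷ bw ∷ wc ∷ ad ∷ ab ∷ bc ∷ bd ∷ ac ∷ []) (δz ∷ deg≤4 P _ ∷ deg≤4 P _ ∷ δw ∷ deg≤4 P _ ∷ deg≤4 P _ ∷ [])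

  no-gemApex : ∀ {j a b w c d} → Linked _≺_ (j ∷ a ∷ b ∷ w ∷ c ∷ d ∷ []) →
    j ~ a → j ~ d → a ~ b → a ~ c → a ~ d → b ~ w → b ~ c → b ~ d → w ~ c → c ~ d → degree P w ≤ 2 → ⊥
  no-gemApex o ja jd ab ac ad bw bc bd wc cd δw = reduce crit gemApex gemApex-choosable (toWitness {a? = valid? gemApex} tt) (distinct o)
    (bd ∷ wc ∷ ja ∷ bw ∷ ad ∷ ab ∷ jd ∷ cd ∷ ac ∷ bc ∷ []) (deg≤4 P _ ∷ deg≤4 P _ ∷ deg≤4 P _ ∷ δw ∷ deg≤4 P _ ∷ deg≤4 P _ ∷ [])

  no-earsGem : ∀ {y u x a b w c d z} → Linked _≺_ (y ∷ u ∷ x ∷ a ∷ b ∷ w ∷ c ∷ d ∷ z ∷ []) →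
    y ~ u → y ~ x → u ~ x → x ~ a → x ~ z → a ~ b → a ~ c → a ~ d → b ~ w → b ~ c → b ~ d → w ~ c → c ~ d → d ~ z → degree P u ≤ 2 → degree P w ≤ 2 → ⊥
  no-earsGem o yu yx ux xa xz ab ac ad bw bc bd wc cd dz δu δw = reduce crit earsGem earsGem-choosable (toWitness {a? = valid? earsGem} tt) (distinct o)
    (xz ∷ dz ∷ yx ∷ yu ∷ ux ∷ xa ∷ cd ∷ bw ∷ wc ∷ ad ∷ bd ∷ ac ∷ ab ∷ bc ∷ []) (deg≤4 P _ ∷ δu ∷ deg≤4 P _ ∷ deg≤4 P _ ∷ deg≤4 P _ ∷ δw ∷ deg≤4 P _ ∷ deg≤4 P _ ∷ deg≤4 P _ ∷ [])

  private
    ~-sym : ∀ {u v} → u ~ v → v ~ u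
    ~-sym = E-sym P

    Gem≺ = Gem _≺_

  gem-deg3 : ∀ {a b w c d} → Gem≺ a b w c d → degree P a ≤ 3 → ⊥
  gem-deg3 (mkGem o ab ac bd cd bc bw wc δw) δa = no-gem3 o ab ac bw bc bd wc cd δa δw

  closedGem-deg3 : ∀ {a b w c d} → Gem≺ a b w c d → a ~ d → degree P a ≤ 3 → ⊥
  closedGem-deg3 (mkGem o ab ac bd cd bc bw wc δw) ad δa = no-closedGem3 o ab ac ad bw bc bd wc cd δa δw

  earThenGem : ∀ {y u a b w c d} → y ≺ u → u ≺ a → y ~ u → y ~ a → u ~ a → degree P u ≤ 2 →
    Gem≺ a b w c d → ⊥
  earThenGem p q yu ya ua δu (mkGem o ab ac bd cd bc bw wc δw) =
    no-earGem (p ∷ q ∷ o) yu ya ua ab ac bw bc bd wc cd δu δw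

  lightThenGem : ∀ {z a b w c d} → z ≺ a → z ~ a → degree P z ≤ 3 → Gem≺ a b w c d → a ~ d → ⊥
  lightThenGem p za δz (mkGem o ab ac bd cd bc bw wc δw) ad =
    no-gemLight (p ∷ o) za ab ac ad bw bc bd wc cd δz δw

  apexOverGem : ∀ {j a b w c d} → j ≺ a → j ~ a → j ~ d → Gem≺ a b w c d → a ~ d → ⊥
  apexOverGem p ja jd (mkGem o ab ac bd cd bc bw wc δw) ad =
    no-gemApex (p ∷ o) ja jd ab ac ad bw bc bd wc cd δw

  Linked-snoc : ∀ xs {y z} → Linked _≺_ (xs ++ y ∷ []) → y ≺ z → Linked _≺_ (xs ++ y ∷ z ∷ [])
  Linked-snoc [] [-] p = p ∷ [-]
  Linked-snoc (x ∷ []) (o ∷ [-]) p = o ∷ p ∷ [-]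
  Linked-snoc (x ∷ x′ ∷ xs) (o ∷ os) p = o ∷ Linked-snoc (x′ ∷ xs) os p

  earThenEdgeGemEdge : ∀ {y u x a b w c d z} → y ≺ u → u ≺ x → y ~ u → y ~ x → u ~ x → degree P u ≤ 2 →
    x ≺ a → x ~ a → x ~ z → Gem≺ a b w c d → a ~ d → d ≺ z → d ~ z → ⊥
  earThenEdgeGemEdge {y} {u} {x} {a} {b} {w} {c} p q yu yx ux δu r xa xz (mkGem o ab ac bd cd bc bw wc δw) ad t dz =
    no-earsGem (Linked-snoc (y ∷ u ∷ x ∷ a ∷ b ∷ w ∷ c ∷ []) (p ∷ q ∷ r ∷ o) t)
      yu yx ux xa xz ab ac ad bw bc bd wc cd dz δu δw

  -- Two intervals with a common end

  module Split {i v j} (iv : i ≺ v) (vj : v ≺ j) (closed : Closed _≺_ i j)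
    (closedˡ : Closed _≺_ i v) (closedʳ : Closed _≺_ v j) where

    private
      NL = LeftNbrs _≺_
      NR = RightNbrs _≺_

    none : ∀ {x : ℕ} {xs : List ℕ} {A : Set} → ¬ A → A → x ∈ xs
    none n a = ⊥-elim (n a)

    -- By closedness a neighbour of `v` is `i`, `j` or inside one of the two parts. A missing edge
    -- to `i` or `j` lets `is` or `js` be empty, which lowers the bound.
    deg-v : ∀ is xs ys js → (i ~ v → i ∈ is) → NR i v xs → NL v j ys → (v ~ j → j ∈ js) →
      degree P v ≤ length (is ++ xs ++ ys ++ js)
    deg-v is xs ys js fi fl fr fj = deg-≤ P (is ++ xs ++ ys ++ js) locate
      where
      locate : ∀ {y} → v ~ y → y ∈ is ++ xs ++ ys ++ js
      locate {y} e with compare y i | compare y v | compare y j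
      ... | tri< y<i _ _ | _ | _ = ⊥-elim (proj₁ (closed iv vj e) y<i)
      ... | tri≈ _ refl _ | _ | _ = ∈-++⁺ˡ (fi (~-sym e))
      ... | tri> _ _ i<y | tri< y<v _ _ | _ = ∈-++⁺ʳ is (∈-++⁺ˡ (fl i<y y<v e))
      ... | _ | tri≈ _ refl _ | _ = ⊥-elim (E-irr P e)
      ... | _ | tri> _ _ v<y | tri< y<j _ _ = ∈-++⁺ʳ is (∈-++⁺ʳ xs (∈-++⁺ˡ (fr v<y y<j e)))
      ... | _ | _ | tri≈ _ refl _ = ∈-++⁺ʳ is (∈-++⁺ʳ xs (∈-++⁺ʳ ys (fj e)))
      ... | _ | _ | tri> _ _ j<y = ⊥-elim (proj₂ (closed iv vj e) j<y)

    toI : i ~ v → i ∈ i ∷ []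
    toI _ = here refl

    toJ : v ~ j → j ∈ j ∷ []
    toJ _ = here refl

    outerˡ : (∀ {x y} → i ≺ x → x ≺ v → ¬ x ~ y) → NL i j (v ∷ [])
    outerˡ t {x} p q e with compare x v
    ... | tri< x<v _ _ = ⊥-elim (t p x<v (~-sym e))
    ... | tri≈ _ refl _ = here refl
    ... | tri> _ _ v<x = ⊥-elim (proj₁ (closedʳ v<x q (~-sym e)) iv)

    outerʳ : ∀ {xs} → (∀ {x y} → i ≺ x → x ≺ v → ¬ x ~ y) → NR v j xs → (j ~ v → v ∈ xs) → NR i j xs
    outerʳ t r f {x} p q e with compare x v
    ... | tri< x<v _ _ = ⊥-elim (t p x<v (~-sym e))
    ... | tri≈ _ refl _ = f e
    ... | tri> _ _ v<x = r v<x q e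

    private
      void : (∀ {x y} → i ≺ x → x ≺ v → ¬ x ~ y) → NR i v []
      void t p q e = ⊥-elim (t p q (~-sym e))

    -- On the left `v` has at most the neighbour `i`. Three shapes on the right can survive: an
    -- edgeless one grows to `ear`, `closedGem` to `edgeGem` and `gemEdge` to `edgeGemEdge`. With
    -- all others `v` has degree at most 3, which completes a reducible configuration.
    split-empty : ∀ {y} → v ~ y → (∀ {x y} → i ≺ x → x ≺ v → ¬ x ~ y) → Shape _≺_ v j → Shape _≺_ i j
    split-empty {y} vy t (empty t′) with T? (E P i v) | T? (E P v j)
    ... | no ne | _ = ⊥-elim (no-pendant vy (deg-v [] [] [] (j ∷ []) (none ne) (void t) (λ p q e → ⊥-elim (t′ p q (~-sym e))) toJ))
    ... | yes _ | no ne = ⊥-elim (no-pendant vy (deg-v (i ∷ []) [] [] [] toI (void t) (λ p q e → ⊥-elim (t′ p q (~-sym e))) (none ne)))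
    ... | yes e | yes f = ear iv vj e f
      (deg-v (i ∷ []) [] [] (j ∷ []) toI (void t) (λ p q e → ⊥-elim (t′ p q (~-sym e))) toJ)
      (outerˡ t) (outerʳ t (λ p q e → ⊥-elim (t′ p q (~-sym e))) (λ _ → here refl))
    split-empty _ t (ear {w} p q e f δ l r) =
      ⊥-elim (no-light (~-sym e) δ (deg-v (i ∷ []) [] (w ∷ []) (j ∷ []) toI (void t) l toJ))
    split-empty _ t (diamond {b} {c} p q s ib ic bc bj cj δb δc ne l r) =
      ⊥-elim (no-diamond3 (p ∷ q ∷ s ∷ [-]) ib ic bc bj cj
        (deg-v (i ∷ []) [] (b ∷ c ∷ []) [] toI (void t) l (none ne)) δb δc)
    split-empty _ t (gem {b} {w} {c} g ne l r) =
      ⊥-elim (gem-deg3 g (deg-v (i ∷ []) [] (b ∷ c ∷ []) [] toI (void t) l (none ne)))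
    split-empty _ t (closedGem {b} {w} {c} g e l r) with T? (E P i v)
    ... | no ne = ⊥-elim (closedGem-deg3 g e (deg-v [] [] (b ∷ c ∷ []) (j ∷ []) (none ne) (void t) l toJ))
    ... | yes f with T? (E P i j)
    -- Here `i` would be adjacent to both ends of the closed gem; hence `edgeGem` can record that
    -- `i` and `j` are not adjacent.
    ...   | yes h = ⊥-elim (apexOverGem iv f h g e)
    ...   | no nh = edgeGem iv f g e nh (outerˡ t)
            (outerʳ t (λ p q e → ∈-++⁺ˡ (r p q e)) (λ _ → there (there (here refl))))
    split-empty _ t (gemEdge {b} {w} {c} {d} g e p f ne l r) with T? (E P i v)
    ... | no nh = ⊥-elim (closedGem-deg3 g e (deg-v [] [] (b ∷ c ∷ d ∷ []) [] (none nh) (void t) l (none ne)))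
    ... | yes h = edgeGemEdge iv h g e p f (outerˡ t) (outerʳ t r (⊥-elim ∘ ne ∘ ~-sym))
    split-empty _ t (edgeGem {a} p e g f ne l r) =
      ⊥-elim (lightThenGem p e (≤-trans (deg-v (i ∷ []) [] (a ∷ []) [] toI (void t) l (none ne)) (n≤1+n 2)) g f)
    split-empty _ t (edgeGemEdge {a} p e g f q h l r) =
      ⊥-elim (lightThenGem p e (deg-v (i ∷ []) [] (a ∷ []) (j ∷ []) toI (void t) l toJ) g f)

    -- By `no-light` the 2-vertex `u` forces degree 4 at `v`, so the edges that could be missing at
    -- `v` are present and the ear joins the right-hand shape in a reducible configuration. If a
    -- closed gem starts at `v`, then `u` is a light neighbour of it.
    split-ear : ∀ {u} → i ≺ u → u ≺ v → i ~ u → u ~ v → degree P u ≤ 2 → NR i v (u ∷ []) → Shape _≺_ v j → ⊥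
    split-ear {u} p q e f δ r (empty t) =
      no-light f δ (deg-v (i ∷ []) (u ∷ []) [] (j ∷ []) toI r (λ p q e → ⊥-elim (t p q (~-sym e))) toJ)
    split-ear {u} p q e f δ r (ear {w} p′ q′ e′ f′ δ′ l _) with T? (E P i v) | T? (E P v j)
    ... | no nh | _ = no-light f δ (deg-v [] (u ∷ []) (w ∷ []) (j ∷ []) (none nh) r l toJ)
    ... | yes _ | no nh = no-light f δ (deg-v (i ∷ []) (u ∷ []) (w ∷ []) [] toI r l (none nh))
    ... | yes h | yes h′ = no-twoEars (p ∷ q ∷ p′ ∷ q′ ∷ [-]) e h f e′ h′ f′ δ δ′
    split-ear {u} p q e f δ r (diamond {b} {c} p′ q′ s ib ic bc bj cj δb δc ne l _) with T? (E P i v)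
    ... | no nh = no-light f δ (deg-v [] (u ∷ []) (b ∷ c ∷ []) [] (none nh) r l (none ne))
    ... | yes h = no-earDiamond (p ∷ q ∷ p′ ∷ q′ ∷ s ∷ [-]) e h f ib ic bc bj cj δ δb δc
    split-ear {u} p q e f δ r (gem {b} {w} {c} g ne l _) with T? (E P i v)
    ... | no nh = no-light f δ (deg-v [] (u ∷ []) (b ∷ c ∷ []) [] (none nh) r l (none ne))
    ... | yes h = earThenGem p q e h f δ g
    split-ear p q e f δ r (closedGem g h _ _) = lightThenGem q f (m≤n⇒m≤1+n δ) g h
    split-ear p q e f δ r (gemEdge g h _ _ _ _ _) = lightThenGem q f (m≤n⇒m≤1+n δ) g h
    split-ear {u} p q e f δ r (edgeGem {a} p′ h g h′ ne l _) =
      no-light f δ (deg-v (i ∷ []) (u ∷ []) (a ∷ []) [] toI r l (none ne))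
    split-ear {u} p q e f δ r (edgeGemEdge {a} p′ h g h′ q′ k l _) with T? (E P i v) | T? (E P v j)
    ... | no nh | _ = no-light f δ (deg-v [] (u ∷ []) (a ∷ []) (j ∷ []) (none nh) r l toJ)
    ... | yes _ | no nh = no-light f δ (deg-v (i ∷ []) (u ∷ []) (a ∷ []) [] toI r l (none nh))
    ... | yes m | yes m′ = earThenEdgeGemEdge p q e m f δ p′ h m′ g h′ q′ k

  -- Three intervals under a crossing

  module Quad {i b c j} (ib : i ≺ b) (bc : b ≺ c) (cj : c ≺ j) (ic : i ~ c) (bj : b ~ j)
    (closed : Closed _≺_ i j) (closed₁ : Closed _≺_ i b) (closed₂ : Closed _≺_ b c) (closed₃ : Closed _≺_ c j) where

    private
      NL = LeftNbrs _≺_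
      NR = RightNbrs _≺_

      Empty : ℕ → ℕ → Set
      Empty i j = ∀ {x y} → i ≺ x → x ≺ j → ¬ x ~ y

      i≺c : i ≺ c
      i≺c = ≺-trans ib bc

      b≺j : b ≺ j
      b≺j = ≺-trans bc cj

      none : ∀ {x : ℕ} {xs : List ℕ} {A : Set} → ¬ A → A → x ∈ xs
      none n a = ⊥-elim (n a)

      one : ∀ {x : ℕ} {A : Set} → A → x ∈ x ∷ []
      one _ = here refl

      voidˡ : ∀ {i j} → Empty i j → NL i j []
      voidˡ t p q e = ⊥-elim (t p q (~-sym e))

      voidʳ : ∀ {i j} → Empty i j → NR i j []
      voidʳ t p q e = ⊥-elim (t p q (~-sym e))

    deg-b : ∀ is xs ys cs → (i ~ b → i ∈ is) → NR i b xs → NL b c ys → (b ~ c → c ∈ cs) →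
      degree P b ≤ length (is ++ xs ++ ys ++ cs ++ j ∷ [])
    deg-b is xs ys cs fi fl fr fc = deg-≤ P (is ++ xs ++ ys ++ cs ++ j ∷ []) locate
      where
      locate : ∀ {y} → b ~ y → y ∈ is ++ xs ++ ys ++ cs ++ j ∷ []
      locate {y} e with compare y i | compare y b | compare y c | compare y j
      ... | tri< y<i _ _ | _ | _ | _ = ⊥-elim (proj₁ (closed ib b≺j e) y<i)
      ... | tri≈ _ refl _ | _ | _ | _ = ∈-++⁺ˡ (fi (~-sym e))
      ... | tri> _ _ i<y | tri< y<b _ _ | _ | _ = ∈-++⁺ʳ is (∈-++⁺ˡ (fl i<y y<b e))
      ... | _ | tri≈ _ refl _ | _ | _ = ⊥-elim (E-irr P e)
      ... | _ | tri> _ _ b<y | tri< y<c _ _ | _ = ∈-++⁺ʳ is (∈-++⁺ʳ xs (∈-++⁺ˡ (fr b<y y<c e)))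
      ... | _ | _ | tri≈ _ refl _ | _ = ∈-++⁺ʳ is (∈-++⁺ʳ xs (∈-++⁺ʳ ys (∈-++⁺ˡ (fc e))))
      ... | _ | _ | tri> _ _ c<y | tri< y<j _ _ = ⊥-elim (proj₁ (closed₃ c<y y<j (~-sym e)) bc)
      ... | _ | _ | _ | tri≈ _ refl _ = ∈-++⁺ʳ is (∈-++⁺ʳ xs (∈-++⁺ʳ ys (∈-++⁺ʳ cs (here refl))))
      ... | _ | _ | _ | tri> _ _ j<y = ⊥-elim (proj₂ (closed ib b≺j e) j<y)

    deg-c : ∀ bs ys zs js → (b ~ c → b ∈ bs) → NR b c ys → NL c j zs → (c ~ j → j ∈ js) →
      degree P c ≤ length (i ∷ bs ++ ys ++ zs ++ js)
    deg-c bs ys zs js fb fl fr fj = deg-≤ P (i ∷ bs ++ ys ++ zs ++ js) locate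
      where
      locate : ∀ {y} → c ~ y → y ∈ i ∷ bs ++ ys ++ zs ++ js
      locate {y} e with compare y i | compare y b | compare y c | compare y j
      ... | tri< y<i _ _ | _ | _ | _ = ⊥-elim (proj₁ (closed i≺c cj e) y<i)
      ... | tri≈ _ refl _ | _ | _ | _ = here refl
      ... | tri> _ _ i<y | tri< y<b _ _ | _ | _ = ⊥-elim (proj₂ (closed₁ i<y y<b (~-sym e)) bc)
      ... | _ | tri≈ _ refl _ | _ | _ = there (∈-++⁺ˡ (fb (~-sym e)))
      ... | _ | tri> _ _ b<y | tri< y<c _ _ | _ = there (∈-++⁺ʳ bs (∈-++⁺ˡ (fl b<y y<c e)))
      ... | _ | _ | tri≈ _ refl _ | _ = ⊥-elim (E-irr P e)
      ... | _ | _ | tri> _ _ c<y | tri< y<j _ _ = there (∈-++⁺ʳ bs (∈-++⁺ʳ ys (∈-++⁺ˡ (fr c<y y<j e))))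
      ... | _ | _ | _ | tri≈ _ refl _ = there (∈-++⁺ʳ bs (∈-++⁺ʳ ys (∈-++⁺ʳ zs (fj e))))
      ... | _ | _ | _ | tri> _ _ j<y = ⊥-elim (proj₂ (closed i≺c cj e) j<y)

    left : Empty i b → NL i j (b ∷ c ∷ [])
    left t {x} p q e with compare x b | compare x c
    ... | tri< x<b _ _ | _ = ⊥-elim (t p x<b (~-sym e))
    ... | tri≈ _ refl _ | _ = here refl
    ... | tri> _ _ b<x | tri< x<c _ _ = ⊥-elim (proj₁ (closed₂ b<x x<c (~-sym e)) ib)
    ... | _ | tri≈ _ refl _ = there (here refl)
    ... | _ | tri> _ _ c<x = ⊥-elim (proj₁ (closed₃ c<x q (~-sym e)) i≺c)

    right : Empty c j → NR i j (b ∷ c ∷ [])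
    right t {x} p q e with compare x b | compare x c
    ... | tri< x<b _ _ | _ = ⊥-elim (proj₂ (closed₁ p x<b (~-sym e)) b≺j)
    ... | tri≈ _ refl _ | _ = here refl
    ... | tri> _ _ b<x | tri< x<c _ _ = ⊥-elim (proj₂ (closed₂ b<x x<c (~-sym e)) cj)
    ... | _ | tri≈ _ refl _ = there (here refl)
    ... | _ | tri> _ _ c<x = ⊥-elim (t c<x q (~-sym e))

    -- All neighbours of `b` and `c` are among the four ends of the crossing. If one of ib, bc, cj
    -- is missing, these degrees are too small; if ij is present as well as these, there is a
    -- reducible K4.
    quad-empty : Empty i b → Empty b c → Empty c j → Shape _≺_ i j
    quad-empty t₁ t₂ t₃ with T? (E P i b) | T? (E P b c) | T? (E P c j)
    ... | no nib | no nbc | _ = ⊥-elim (no-pendant bj (deg-b [] [] [] [] (none nib) (voidʳ t₁) (voidˡ t₂) (none nbc)))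
    ... | no nib | yes f | _ = ⊥-elim (no-light f (deg-b [] [] [] (c ∷ []) (none nib) (voidʳ t₁) (voidˡ t₂) one)
            (deg-c (b ∷ []) [] [] (j ∷ []) one (voidʳ t₂) (voidˡ t₃) one))
    ... | _ | no nbc | no ncj = ⊥-elim (no-pendant (~-sym ic) (deg-c [] [] [] [] (none nbc) (voidʳ t₂) (voidˡ t₃) (none ncj)))
    ... | _ | yes f | no ncj = ⊥-elim (no-light (~-sym f) (deg-c (b ∷ []) [] [] [] one (voidʳ t₂) (voidˡ t₃) (none ncj))
            (deg-b (i ∷ []) [] [] (c ∷ []) one (voidʳ t₁) (voidˡ t₂) one))
    ... | yes e | no nbc | yes g = ⊥-elim (no-fourCycle (ib ∷ bc ∷ cj ∷ [-]) e ic bj g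
            (deg-b (i ∷ []) [] [] [] one (voidʳ t₁) (voidˡ t₂) (none nbc))
            (deg-c [] [] [] (j ∷ []) (none nbc) (voidʳ t₂) (voidˡ t₃) one))
    ... | yes e | yes f | yes g with T? (E P i j)
    ...   | yes h = ⊥-elim (no-k4 (ib ∷ bc ∷ cj ∷ [-]) e ic h f bj g
            (deg-b (i ∷ []) [] [] (c ∷ []) one (voidʳ t₁) (voidˡ t₂) one)
            (deg-c (b ∷ []) [] [] (j ∷ []) one (voidʳ t₂) (voidˡ t₃) one))
    ...   | no nh = diamond ib bc cj e ic f bj g
            (deg-b (i ∷ []) [] [] (c ∷ []) one (voidʳ t₁) (voidˡ t₂) one)
            (deg-c (b ∷ []) [] [] (j ∷ []) one (voidʳ t₂) (voidˡ t₃) one) nh (left t₁) (right t₃)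

    -- The 2-vertex `w` forces degree 4 at `b` and at `c`, hence the edges ib, bc and cj. Only ij
    -- remains open and separates `gem` from `closedGem`.
    quad-middle : ∀ {w} → b ≺ w → w ≺ c → b ~ w → w ~ c → degree P w ≤ 2 → NL b c (w ∷ []) → NR b c (w ∷ []) →
      Empty i b → Empty c j → Shape _≺_ i j
    quad-middle {w} p q bw wc δ l r t₁ t₃ with T? (E P i b) | T? (E P b c) | T? (E P c j)
    ... | no n | _ | _ = ⊥-elim (no-light (~-sym bw) δ (deg-b [] [] (w ∷ []) (c ∷ []) (none n) (voidʳ t₁) l one))
    ... | _ | no n | _ = ⊥-elim (no-light (~-sym bw) δ (deg-b (i ∷ []) [] (w ∷ []) [] one (voidʳ t₁) l (none n)))
    ... | _ | _ | no n = ⊥-elim (no-light wc δ (deg-c (b ∷ []) (w ∷ []) [] [] one r (voidˡ t₃) (none n)))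
    ... | yes e | yes f | yes g with T? (E P i j)
    ...   | yes h = closedGem (mkGem (ib ∷ p ∷ q ∷ cj ∷ [-]) e ic bj g f bw wc δ) h (left t₁) (right t₃)
    ...   | no nh = gem (mkGem (ib ∷ p ∷ q ∷ cj ∷ [-]) e ic bj g f bw wc δ) nh (left t₁) (right t₃)

    -- The 2-vertex `u` forces degree 4 at `b`, hence ib and bc; the configurations `sideEar3` and
    -- `sideEar2` cover the presence and absence of cj.
    quad-side : ∀ {u} → i ≺ u → u ≺ b → i ~ u → u ~ b → degree P u ≤ 2 → NR i b (u ∷ []) →
      Empty b c → Empty c j → ⊥
    quad-side {u} p q iu ub δ r t₂ t₃ with T? (E P i b) | T? (E P b c) | T? (E P c j)
    ... | no n | _ | _ = no-light ub δ (deg-b [] (u ∷ []) [] (c ∷ []) (none n) r (voidˡ t₂) one)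
    ... | _ | no n | _ = no-light ub δ (deg-b (i ∷ []) (u ∷ []) [] [] one r (voidˡ t₂) (none n))
    ... | yes e | yes f | yes g = no-sideEar3 (p ∷ q ∷ bc ∷ cj ∷ [-]) iu e ic ub f bj g δ
          (deg-c (b ∷ []) [] [] (j ∷ []) one (voidʳ t₂) (voidˡ t₃) one)
    ... | yes e | yes f | no n = no-sideEar2 (p ∷ q ∷ bc ∷ cj ∷ [-]) iu e ic ub f bj δ
          (deg-c (b ∷ []) [] [] [] one (voidʳ t₂) (voidˡ t₃) (none n))

    quad-sides : ∀ {u v} → i ≺ u → u ≺ b → i ~ u → u ~ b → degree P u ≤ 2 → NR i b (u ∷ []) → Empty b c →
      c ≺ v → v ≺ j → c ~ v → v ~ j → degree P v ≤ 2 → NL c j (v ∷ []) → ⊥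
    quad-sides {u} {v} p q iu ub δ r t₂ p′ q′ cv vj δ′ l with T? (E P i b) | T? (E P b c) | T? (E P c j)
    ... | no n | _ | _ = no-light ub δ (deg-b [] (u ∷ []) [] (c ∷ []) (none n) r (voidˡ t₂) one)
    ... | _ | no n | _ = no-light ub δ (deg-b (i ∷ []) (u ∷ []) [] [] one r (voidˡ t₂) (none n))
    ... | _ | _ | no n = no-light (~-sym cv) δ′ (deg-c (b ∷ []) [] (v ∷ []) [] one (voidʳ t₂) l (none n))
    ... | yes e | yes f | yes g = no-sideEars (p ∷ q ∷ bc ∷ p′ ∷ q′ ∷ [-]) iu e ic ub f bj cv g vj δ δ′

    quad-side-middle : ∀ {u w} → i ≺ u → u ≺ b → i ~ u → u ~ b → degree P u ≤ 2 →
      b ≺ w → w ≺ c → b ~ w → w ~ c → degree P w ≤ 2 → NR b c (w ∷ []) → Empty c j → ⊥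
    quad-side-middle {u} {w} p q iu ub δ p′ q′ bw wc δ′ r t₃ with T? (E P b c) | T? (E P c j)
    ... | no n | _ = no-light wc δ′ (deg-c [] (w ∷ []) [] (j ∷ []) (none n) r (voidˡ t₃) one)
    ... | _ | no n = no-light wc δ′ (deg-c (b ∷ []) (w ∷ []) [] [] one r (voidˡ t₃) (none n))
    ... | yes f | yes g = no-bypassEar (p ∷ q ∷ p′ ∷ q′ ∷ cj ∷ [-]) iu ic ub bw f bj wc g δ δ′

    -- If bc is present, `twoBypassesEar` applies; if not, the 2-vertices force ib and cj, and
    -- `twoEarsBypass` applies.
    quad-all : ∀ {u w v} → i ≺ u → u ≺ b → i ~ u → u ~ b → degree P u ≤ 2 → NR i b (u ∷ []) →
      b ≺ w → w ≺ c → b ~ w → w ~ c → degree P w ≤ 2 → NL b c (w ∷ []) → NR b c (w ∷ []) →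
      c ≺ v → v ≺ j → c ~ v → v ~ j → degree P v ≤ 2 → NL c j (v ∷ []) → ⊥
    quad-all {u} {w} {v} p q iu ub δ r p′ q′ bw wc δ′ l′ r′ p″ q″ cv vj δ″ l with T? (E P b c)
    ... | yes f = no-twoBypassesEar (p ∷ q ∷ p′ ∷ q′ ∷ p″ ∷ q″ ∷ [-]) iu ic ub bw f bj wc cv vj δ δ′ δ″
    ... | no nbc with T? (E P i b) | T? (E P c j)
    ...   | no n | _ = no-light ub δ (deg-b [] (u ∷ []) (w ∷ []) [] (none n) r l′ (none nbc))
    ...   | _ | no n = no-light (~-sym cv) δ″ (deg-c [] (w ∷ []) (v ∷ []) [] (none nbc) r′ l (none n))
    ...   | yes e | yes g = no-twoEarsBypass (p ∷ q ∷ p′ ∷ q′ ∷ p″ ∷ q″ ∷ [-]) iu e ic ub bw bj wc cv g vj δ δ′ δ″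

-- Extremal positions in an interval

module _ {Q : ℕ → Set} (Q? : Decidable Q) (i : ℕ) where

  Nowhere : ℕ → Set
  Nowhere j = ∀ {x} → i < x → x < j → ¬ Q x

  greatest : ∀ j → (∃[ k ] (i < k × k < j × Q k × (∀ {x} → k < x → x < j → ¬ Q x))) ⊎ Nowhere j
  greatest zero = inj₂ λ _ ()
  greatest (suc j) with (i <? j) ×-dec Q? j
  ... | yes (i<j , q) = inj₁ (j , i<j , n<1+n j , q , λ j<x x<sj → ⊥-elim (<⇒≱ j<x (≤-pred x<sj)))
  ... | no ¬p with greatest j
  ...   | inj₁ (k , i<k , k<j , q , top) = inj₁ (k , i<k , m≤n⇒m≤1+n k<j , q , top′)
    where
    top′ : ∀ {x} → k < x → x < suc j → ¬ Q x
    top′ {x} k<x x<sj with m≤n⇒m<n∨m≡n (≤-pred x<sj)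
    ... | inj₁ x<j = top k<x x<j
    ... | inj₂ refl = λ q → ¬p (<-trans i<k k<x , q)
  ...   | inj₂ none = inj₂ none′
    where
    none′ : Nowhere (suc j)
    none′ {x} i<x x<sj with m≤n⇒m<n∨m≡n (≤-pred x<sj)
    ... | inj₁ x<j = none i<x x<j
    ... | inj₂ refl = λ q → ¬p (i<x , q)

  least : ∀ j → (∃[ k ] (i < k × k < j × Q k × Nowhere k)) ⊎ Nowhere j
  least zero = inj₂ λ _ ()
  least (suc j) with least j
  ... | inj₁ (k , i<k , k<j , q , low) = inj₁ (k , i<k , m≤n⇒m≤1+n k<j , q , low)
  ... | inj₂ none with (i <? j) ×-dec Q? j
  ...   | yes (i<j , q) = inj₁ (j , i<j , n<1+n j , q , none)
  ...   | no ¬p = inj₂ none′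
    where
    none′ : Nowhere (suc j)
    none′ {x} i<x x<sj with m≤n⇒m<n∨m≡n (≤-pred x<sj)
    ... | inj₁ x<j = none i<x x<j
    ... | inj₂ refl = λ q → ¬p (i<x , q)

-- The induction over intervals

module _ {n} {P : Plane n} {L : Lists} (crit : Critical P L) where
  open Shapes P
  private
    module ↑ = Ordered crit <-isStrictTotalOrder
    module ↓ = Ordered crit (Flip.isStrictTotalOrder <-isStrictTotalOrder)

    ~-sym : ∀ {u v} → u ~ v → v ~ u
    ~-sym = E-sym P

    X : ℕ → ℕ → ℕ → ℕ → Set
    X = Crossing (E P)

    flipClosed : ∀ {i j} → Closed _<_ i j → Closed (λ x y → y < x) j i
    flipClosed c p q e = Product.swap (c q p e)

  -- A crossing within the interval that comes within distance 1 of both ends. All shapes other than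
  -- `empty` and `ear` have one, which makes `apart` applicable at a common end of two intervals.
  record Near (i j : ℕ) : Set where
    field
      {a b c d x y} : ℕ
      crossing : X a b c d
      i≤a : i ≤ a
      d≤j : d ≤ j
      x∈ : OneOf a b c d x
      y∈ : OneOf a b c d y
      atLeft : Within1 (E P) x i
      atRight : Within1 (E P) y j

    a<d : a < d
    a<d = <-trans (proj₁ crossing) (<-trans (proj₁ (proj₂ crossing)) (proj₁ (proj₂ (proj₂ crossing))))

  open Near

  data Thin (i j : ℕ) : Set where
    empty : (∀ {x y} → i < x → x < j → ¬ x ~ y) → Thin i j
    ear : ∀ {w} → i < w → w < j → i ~ w → w ~ j → degree P w ≤ 2 →
      LeftNbrs _<_ i j (w ∷ []) → RightNbrs _<_ i j (w ∷ []) → Thin i j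

  gemCrossing : ∀ {a b w c d} → Gem _<_ a b w c d → X a b c d
  gemCrossing (mkGem (p ∷ q ∷ r ∷ t ∷ [-]) _ ac bd _ _ _ _ _) = p , <-trans q r , t , ac , bd

  thin⊎near : ∀ {i j} → Shape _<_ i j → Thin i j ⊎ Near i j
  thin⊎near (empty t) = inj₁ (empty t)
  thin⊎near (ear p q e f δ l r) = inj₁ (ear p q e f δ l r)
  thin⊎near (diamond p q s ib ic bc bj cj _ _ _ _ _) = inj₂ record
    { crossing = p , q , s , ic , bj ; i≤a = ≤-refl ; d≤j = ≤-refl ; x∈ = 1st ; y∈ = 4th ; atLeft = inj₁ refl ; atRight = inj₁ refl }
  thin⊎near (gem g _ _ _) = inj₂ record
    { crossing = gemCrossing g ; i≤a = ≤-refl ; d≤j = ≤-refl ; x∈ = 1st ; y∈ = 4th ; atLeft = inj₁ refl ; atRight = inj₁ refl }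
  thin⊎near (closedGem g _ _ _) = inj₂ record
    { crossing = gemCrossing g ; i≤a = ≤-refl ; d≤j = ≤-refl ; x∈ = 1st ; y∈ = 4th ; atLeft = inj₁ refl ; atRight = inj₁ refl }
  thin⊎near (gemEdge g _ p f _ _ _) = inj₂ record
    { crossing = gemCrossing g ; i≤a = ≤-refl ; d≤j = <⇒≤ p ; x∈ = 1st ; y∈ = 4th ; atLeft = inj₁ refl ; atRight = inj₂ f }
  thin⊎near (edgeGem p f g _ _ _ _) = inj₂ record
    { crossing = gemCrossing g ; i≤a = <⇒≤ p ; d≤j = ≤-refl ; x∈ = 1st ; y∈ = 4th ; atLeft = inj₂ (~-sym f) ; atRight = inj₁ refl }
  thin⊎near (edgeGemEdge p e g _ q f _ _) = inj₂ record
    { crossing = gemCrossing g ; i≤a = <⇒≤ p ; d≤j = <⇒≤ q ; x∈ = 1st ; y∈ = 4th ; atLeft = inj₂ (~-sym e) ; atRight = inj₂ f }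

  -- Both crossings come within distance 1 of `v`, so they coincide; but one lies before `v` and the
  -- other after it.
  near-near : ∀ {i v j} → Near i v → Near v j → ⊥
  near-near N M with apart P (crossing N) (crossing M) (y∈ N) (x∈ M) (atRight N) (atLeft M)
  ... | refl , _ = <⇒≱ (a<d N) (≤-trans (d≤j N) (i≤a M))

  -- By `near-near` one part is thin; if it is the right one, the mirror image of the argument
  -- applies.
  split : ∀ {i v j y} → i < v → v < j → v ~ y → Closed _<_ i j → Closed _<_ i v → Closed _<_ v j →
    Shape _<_ i v → Shape _<_ v j → Shape _<_ i j
  split iv vj vy c c₁ c₂ l r with thin⊎near l | thin⊎near r
  ... | inj₁ (empty t) | _ = ↑.Split.split-empty iv vj c c₁ c₂ vy t r
  ... | inj₁ (ear p q e f δ _ nr) | _ = ⊥-elim (↑.Split.split-ear iv vj c c₁ c₂ p q e f δ nr r)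
  ... | inj₂ _ | inj₁ (empty t) = flipShape (↓.Split.split-empty vj iv (flipClosed c) (flipClosed c₂) (flipClosed c₁) vy
        (λ p q → t q p) (flipShape l))
  ... | inj₂ _ | inj₁ (ear p q e f δ nl _) = ⊥-elim (↓.Split.split-ear vj iv (flipClosed c) (flipClosed c₂) (flipClosed c₁)
        q p (~-sym f) (~-sym e) δ (λ p q → nl q p) (flipShape l))
  ... | inj₂ N | inj₂ M = ⊥-elim (near-near N M)

  -- The left end of each part is an end-vertex of the crossing of ic and bj. A crossing near it
  -- would be this very crossing, which does not fit into the part; so all three parts are thin. Of
  -- the eight combinations of `empty` and `ear` two are mirror images of others, and only two leave
  -- a shape.
  quad : ∀ {i b c j} → i < b → b < c → c < j → i ~ c → b ~ j →
    Closed _<_ i j → Closed _<_ i b → Closed _<_ b c → Closed _<_ c j →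
    Shape _<_ i b → Shape _<_ b c → Shape _<_ c j → Shape _<_ i j
  quad {i} {b} {c} {j} ib bc cj ic bj k k₁ k₂ k₃ s₁ s₂ s₃ with thin⊎near s₁ | thin⊎near s₂ | thin⊎near s₃
  ... | inj₂ N | _ | _ with apart P (ib , bc , cj , ic , bj) (crossing N) 1st (x∈ N) (inj₁ refl) (atLeft N)
  ...   | _ , _ , _ , refl = ⊥-elim (<⇒≱ (<-trans bc cj) (d≤j N))
  quad ib bc cj ic bj k k₁ k₂ k₃ s₁ s₂ s₃ | _ | inj₂ N | _
    with apart P (ib , bc , cj , ic , bj) (crossing N) 2nd (x∈ N) (inj₁ refl) (atLeft N)
  ...   | _ , _ , _ , refl = ⊥-elim (<⇒≱ cj (d≤j N))
  quad ib bc cj ic bj k k₁ k₂ k₃ s₁ s₂ s₃ | _ | _ | inj₂ N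
    with apart P (ib , bc , cj , ic , bj) (crossing N) 3rd (x∈ N) (inj₁ refl) (atLeft N)
  ...   | refl , _ = ⊥-elim (<⇒≱ (<-trans ib bc) (i≤a N))
  quad ib bc cj ic bj k k₁ k₂ k₃ s₁ s₂ s₃ | inj₁ (empty t₁) | inj₁ (empty t₂) | inj₁ (empty t₃) = ↑.Quad.quad-empty ib bc cj ic bj k k₁ k₂ k₃ t₁ t₂ t₃
  quad ib bc cj ic bj k k₁ k₂ k₃ s₁ s₂ s₃ | inj₁ (ear p q e f δ _ r) | inj₁ (empty t₂) | inj₁ (empty t₃) =
        ⊥-elim (↑.Quad.quad-side ib bc cj ic bj k k₁ k₂ k₃ p q e f δ r t₂ t₃)
  quad ib bc cj ic bj k k₁ k₂ k₃ s₁ s₂ s₃ | inj₁ (empty t₁) | inj₁ (ear p q e f δ l r) | inj₁ (empty t₃) =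
        ↑.Quad.quad-middle ib bc cj ic bj k k₁ k₂ k₃ p q e f δ l r t₁ t₃
  quad ib bc cj ic bj k k₁ k₂ k₃ s₁ s₂ s₃ | inj₁ (empty t₁) | inj₁ (empty t₂) | inj₁ (ear p q e f δ l _) =
        ⊥-elim (↓.Quad.quad-side cj bc ib (~-sym bj) (~-sym ic) (flipClosed k) (flipClosed k₃) (flipClosed k₂) (flipClosed k₁)
          q p (~-sym f) (~-sym e) δ (λ p q → l q p) (λ p q → t₂ q p) (λ p q → t₁ q p))
  quad ib bc cj ic bj k k₁ k₂ k₃ s₁ s₂ s₃ | inj₁ (ear p q e f δ _ r) | inj₁ (empty t₂) | inj₁ (ear p′ q′ e′ f′ δ′ l _) =
        ⊥-elim (↑.Quad.quad-sides ib bc cj ic bj k k₁ k₂ k₃ p q e f δ r t₂ p′ q′ e′ f′ δ′ l)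
  quad ib bc cj ic bj k k₁ k₂ k₃ s₁ s₂ s₃ | inj₁ (ear p q e f δ _ _) | inj₁ (ear p′ q′ e′ f′ δ′ _ r) | inj₁ (empty t₃) =
        ⊥-elim (↑.Quad.quad-side-middle ib bc cj ic bj k k₁ k₂ k₃ p q e f δ p′ q′ e′ f′ δ′ r t₃)
  quad ib bc cj ic bj k k₁ k₂ k₃ s₁ s₂ s₃ | inj₁ (empty t₁) | inj₁ (ear p q e f δ l _) | inj₁ (ear p′ q′ e′ f′ δ′ _ _) =
        ⊥-elim (↓.Quad.quad-side-middle cj bc ib (~-sym bj) (~-sym ic) (flipClosed k) (flipClosed k₃) (flipClosed k₂) (flipClosed k₁)
          q′ p′ (~-sym f′) (~-sym e′) δ′ q p (~-sym f) (~-sym e) δ (λ p q → l q p) (λ p q → t₁ q p))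
  quad ib bc cj ic bj k k₁ k₂ k₃ s₁ s₂ s₃ | inj₁ (ear p q e f δ _ r) | inj₁ (ear p′ q′ e′ f′ δ′ l′ r′) | inj₁ (ear p″ q″ e″ f″ δ″ l _) =
        ⊥-elim (↑.Quad.quad-all ib bc cj ic bj k k₁ k₂ k₃ p q e f δ r p′ q′ e′ f′ δ′ l′ r′ p″ q″ e″ f″ δ″ l)

  private
    Live : ℕ → Set
    Live x = 0 < degree P x

    live⁺ : ∀ {x y} → x ~ y → Live x
    live⁺ {x} e with nbrs (E P) n x | ∈-nbrs⁺ P e
    ... | _ ∷ _ | _ = s≤s z≤n

    live⁻ : ∀ {x} → Live x → ∃[ y ] x ~ y
    live⁻ {x} p with nbrs (E P) n x in eq
    ... | y ∷ _ = y , ∈-nbrs⁻ P (subst (y ∈_) (sym eq) (here refl))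
    live⁻ {x} () | []

  Crossed : ℕ → ℕ → Set
  Crossed i k = ∃[ b ] (b < k × i < b × ∃[ d ] (d < n × k < d × b ~ d))

  crossed? : ∀ i k → Dec (Crossed i k)
  crossed? i k = anyUpTo? (λ b → (i <? b) ×-dec anyUpTo? (λ d → (k <? d) ×-dec T? (E P b d)) n) k

  -- Split at the farthest neighbour of i inside the interval (at the far end of the crossing,
  -- if the edge to that neighbour is crossed), or else at the first vertex that is not isolated.
  shape : ∀ f {i j} → j ≤ i + f → i < j → Closed _<_ i j → Shape _<_ i j
  shape zero {i} le lt closed = ⊥-elim (<⇒≱ lt (subst (_ ≤_) (+-identityʳ i) le))
  shape (suc f) {i} {j} le lt closed = choose (greatest (λ x → T? (E P i x)) i j)
    where
    below : ∀ {v} → v < j → v ≤ i + f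
    below v<j = ≤-pred (≤-trans v<j (subst (j ≤_) (+-suc i f) le))

    above : ∀ {v} → i < v → j ≤ v + f
    above i<v = ≤-trans (subst (j ≤_) (+-suc i f) le) (+-monoˡ-≤ f i<v)

    cut : ∀ {v y} → i < v → v < j → v ~ y → Closed _<_ i v → Closed _<_ v j → Shape _<_ i j
    cut i<v v<j vy c₁ c₂ = split i<v v<j vy closed c₁ c₂
      (shape f (below v<j) i<v c₁) (shape f (above i<v) v<j c₂)

    choose : _ → Shape _<_ i j
    choose (inj₂ none) with least (λ x → 0 <? degree P x) i j
    ... | inj₂ dead = empty λ p q e → dead p q (live⁺ e)
    -- All vertices strictly between `i` and `v` are isolated, so the left part is trivially closed.
    ... | inj₁ (v , i<v , v<j , alive , low) = cut i<v v<j (proj₂ (live⁻ alive))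
          (λ p q e → ⊥-elim (low p q (live⁺ e))) right
      where
      right : Closed _<_ v j
      right {x} {y} v<x x<j e = not-left , proj₂ (closed (<-trans i<v v<x) x<j e)
        where
        not-left : ¬ y < v
        not-left y<v with m≤n⇒m<n∨m≡n (≮⇒≥ (proj₁ (closed (<-trans i<v v<x) x<j e)))
        ... | inj₁ i<y = low i<y y<v (live⁺ (~-sym e))
        ... | inj₂ refl = none (<-trans i<v v<x) x<j (~-sym e)
    choose (inj₁ (k , i<k , k<j , ik , top)) with crossed? i k
    ... | no uncrossed = cut i<k k<j (~-sym ik) left right
      where
      left : Closed _<_ i k
      left {x} {y} i<x x<k e = proj₁ (closed i<x (<-trans x<k k<j) e) ,
        λ k<y → uncrossed (x , x<k , i<x , y , E-bound P (~-sym e) , k<y , e)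
      right : Closed _<_ k j
      right {x} {y} k<x x<j e = not-left , proj₂ (closed (<-trans i<k k<x) x<j e)
        where
        not-left : ¬ y < k
        not-left y<k with m≤n⇒m<n∨m≡n (≮⇒≥ (proj₁ (closed (<-trans i<k k<x) x<j e)))
        ... | inj₁ i<y = uncrossed (y , y<k , i<y , x , E-bound P e , k<x , ~-sym e)
        ... | inj₂ refl = top k<x x<j (~-sym e)
    -- Closedness keeps `d` from passing `j`. Before `j` it is a place to split; at `j` the crossing
    -- spans the whole interval.
    ... | yes (b , b<k , i<b , d , _ , k<d , bd) = inside (m≤n⇒m<n∨m≡n (≮⇒≥ (proj₂ (closed i<b (<-trans b<k k<j) bd))))
      where
      χ : X i b k d
      χ = i<b , b<k , k<d , ik , bd

      -- With `x` itself as the intermediate vertex, `apart` says that crossings with a common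
      -- end-vertex coincide.
      meets : ∀ {a b′ c d′ x} → X a b′ c d′ → OneOf i b k d x → OneOf a b′ c d′ x →
        i ≡ a × b ≡ b′ × k ≡ c × d ≡ d′
      meets χ′ o o′ = apart P χ χ′ o o′ (inj₁ refl) (inj₁ refl)

      closed-id : d ≤ j → Closed _<_ i d
      closed-id d≤j {x} {y} i<x x<d e = proj₁ (closed i<x (<-≤-trans x<d d≤j) e) , not-right
        where
        -- An edge passing over `d` crosses ik if it starts before `k`, and bd otherwise. Either way
        -- there is a second crossing that shares an end-vertex with the first.
        not-right : ¬ d < y
        not-right d<y with <-cmp x k
        ... | tri< x<k _ _ = <-irrefl (proj₂ (proj₂ (proj₂ (meets (i<x , x<k , <-trans k<d d<y , ik , e) 1st 1st)))) d<y
        ... | tri≈ _ refl _ = <-irrefl (proj₁ (meets (b<k , k<d , d<y , bd , e) 2nd 1st)) i<b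
        ... | tri> _ _ k<x = <-irrefl (proj₁ (meets (<-trans b<k k<x , x<d , d<y , bd , e) 2nd 1st)) i<b

      inside : d < j ⊎ d ≡ j → Shape _<_ i j
      inside (inj₁ d<j) = cut (<-trans i<k k<d) d<j (~-sym bd) (closed-id (<⇒≤ d<j)) right
        where
        right : Closed _<_ d j
        right {x} {y} d<x x<j e = not-left , proj₂ (closed i<x x<j e)
          where
          i<x : i < x
          i<x = <-trans i<k (<-trans k<d d<x)
          not-left : ¬ y < d
          not-left y<d with m≤n⇒m<n∨m≡n (≮⇒≥ (proj₁ (closed i<x x<j e)))
          ... | inj₁ i<y = proj₂ (closed-id (<⇒≤ d<j) i<y y<d (~-sym e)) d<x
          ... | inj₂ refl = top (<-trans k<d d<x) x<j (~-sym e)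
      inside (inj₂ refl) = quad i<b b<k k<j ik bd closed c₁ c₂ c₃
          (shape f (below (<-trans b<k k<j)) i<b c₁)
          (shape f (≤-trans (below k<j) (+-monoˡ-≤ f (<⇒≤ i<b))) b<k c₂)
          (shape f (above i<k) k<j c₃)
        where
        c₁ : Closed _<_ i b
        c₁ {x} {y} i<x x<b e = proj₁ outer , not-right
          where
          outer = closed i<x (<-trans x<b (<-trans b<k k<j)) e
          not-right : ¬ b < y
          not-right b<y with m≤n⇒m<n∨m≡n (≮⇒≥ (proj₂ outer))
          ... | inj₁ y<j = <-irrefl (proj₁ (meets (x<b , b<y , y<j , e , bd) 2nd 2nd)) i<x
          ... | inj₂ refl = <-irrefl (sym (proj₁ (proj₂ (meets (i<x , <-trans x<b b<k , k<j , ik , e) 1st 1st)))) x<b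
        c₂ : Closed _<_ b k
        c₂ {x} {y} b<x x<k e = not-left , not-right
          where
          outer = closed (<-trans i<b b<x) (<-trans x<k k<j) e
          not-left : ¬ y < b
          not-left y<b = <-irrefl (sym (proj₁ (proj₂ (proj₂ (meets (y<b , b<x , <-trans x<k k<j , ~-sym e , bd) 2nd 2nd))))) x<k
          not-right : ¬ k < y
          not-right k<y = <-irrefl (proj₁ (proj₂ (meets (<-trans i<b b<x , x<k , k<y , ik , e) 1st 1st))) b<x
        c₃ : Closed _<_ k j
        c₃ {x} {y} k<x x<j e = not-left , proj₂ outer
          where
          outer = closed (<-trans i<k k<x) x<j e
          not-left : ¬ y < k
          not-left y<k with m≤n⇒m<n∨m≡n (≮⇒≥ (proj₁ outer))
          ... | inj₁ i<y = <-irrefl (sym (proj₂ (proj₂ (proj₂ (meets (i<y , y<k , k<x , ik , ~-sym e) 1st 1st))))) x<j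
          ... | inj₂ refl = <-irrefl (proj₁ (proj₂ (proj₂ (meets (i<b , <-trans b<k k<x , x<j , ~-sym e , bd) 2nd 2nd)))) k<x

-- Nothing lies outside the interval of all positions, so position 0 has no neighbours but those
-- inside it and possibly the last position. In every shape its degree is then at most 3, which
-- completes a reducible configuration.
critical-impossible : ∀ {n} {P : Plane n} {L : Lists} → ¬ Critical P L
critical-impossible {n} {P} crit =
  Critical.stuck crit ((λ _ _ → 0) , (⊥-elim ∘ edgeless) , (λ e _ _ _ → edgeless e) , (⊥-elim ∘ edgeless))
  where
  open Shapes P
  open Ordered crit <-isStrictTotalOrder

  edgeless : ∀ {u v} → ¬ u ~ v
  -- The number of positions is passed as a variable, so that matching it with `suc N` names the
  -- last position.
  edgeless {u} {v} uv = impossible n (E-bound P) uv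
    where
    impossible : ∀ m → (∀ {u v} → u ~ v → u < m) → u ~ v → ⊥
    impossible zero bound e = <⇒≱ (bound e) z≤n
    impossible (suc N) bound e = conclude (shape crit N ≤-refl 0<N closed)
      where
      ≤N : ∀ {u v} → u ~ v → v ≤ N
      ≤N e = ≤-pred (bound (E-sym P e))

      0<N : 0 < N
      0<N = n≢0⇒n>0 λ { refl → E-irr P (subst₂ _~_ (n≤0⇒n≡0 (≤N (E-sym P e))) (n≤0⇒n≡0 (≤N e)) e) }

      closed : Closed _<_ 0 N
      closed _ _ e = (λ ()) , ≤⇒≯ (≤N e)

      deg-0 : ∀ xs js → LeftNbrs _<_ 0 N xs → (0 ~ N → N ∈ js) → degree P 0 ≤ length (xs ++ js)
      deg-0 xs js l f = deg-≤ P (xs ++ js) locate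
        where
        locate : ∀ {y} → 0 ~ y → y ∈ xs ++ js
        locate {zero} e = ⊥-elim (E-irr P e)
        locate {suc y} e with m≤n⇒m<n∨m≡n (≤N e)
        ... | inj₁ lt = ∈-++⁺ˡ (l (s≤s z≤n) lt e)
        ... | inj₂ refl = ∈-++⁺ʳ xs (f e)

      conclude : Shape _<_ 0 N → ⊥
      -- All edges join the two ends, so 0 has degree 1.
      conclude (empty t) = no-pendant (proj₂ (at-0 e))
          (deg-0 [] (N ∷ []) (λ p q e → ⊥-elim (t p q (E-sym P e))) (λ _ → here refl))
        where
        at-0 : ∀ {u v} → u ~ v → ∃[ y ] 0 ~ y
        at-0 {zero} {y} e = y , e
        at-0 {suc x} {zero} e = suc x , E-sym P e
        at-0 {suc x} {suc y} e with m≤n⇒m<n∨m≡n (≤N (E-sym P e)) | m≤n⇒m<n∨m≡n (≤N e)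
        ... | inj₁ lt | _ = ⊥-elim (t (s≤s z≤n) lt e)
        ... | inj₂ refl | inj₁ lt = ⊥-elim (t (s≤s z≤n) lt (E-sym P e))
        ... | inj₂ refl | inj₂ refl = ⊥-elim (E-irr P e)
      conclude (ear {w} _ _ e _ δ l _) =
        no-light (E-sym P e) δ (m≤n⇒m≤1+n (deg-0 (w ∷ []) (N ∷ []) l (λ _ → here refl)))
      conclude (diamond {b} {c} p q s ib ic bc bj cj δb δc ne l _) = no-diamond3 (p ∷ q ∷ s ∷ [-]) ib ic bc bj cj
        (m≤n⇒m≤1+n (deg-0 (b ∷ c ∷ []) [] l (⊥-elim ∘ ne))) δb δc
      conclude (gem {b} {w} {c} g ne l _) = gem-deg3 g (m≤n⇒m≤1+n (deg-0 (b ∷ c ∷ []) [] l (⊥-elim ∘ ne)))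
      conclude (closedGem {b} {w} {c} g e l _) = closedGem-deg3 g e (deg-0 (b ∷ c ∷ []) (N ∷ []) l (λ _ → here refl))
      conclude (gemEdge {b} {w} {c} {d} g e _ _ ne l _) = closedGem-deg3 g e (deg-0 (b ∷ c ∷ d ∷ []) [] l (⊥-elim ∘ ne))
      conclude (edgeGem {a} p e g f ne l _) =
        lightThenGem p e (≤-trans (deg-0 (a ∷ []) [] l (⊥-elim ∘ ne)) (s≤s z≤n)) g f
      conclude (edgeGemEdge {a} p e g f _ _ l _) =
        lightThenGem p e (m≤n⇒m≤1+n (deg-0 (a ∷ []) (N ∷ []) l (λ _ → here refl))) g f

-- From drawings to positions on the circle

-- Descent on the number of edges: once all smaller graphs are settled, an uncolourable one would be
-- critical.
not-uncolourable : ∀ {n} (P : Plane n) (L : Lists) → LongLists P L → ¬ ¬ Colourable P L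
not-uncolourable P L = go P (<-wellFounded (edgeCount P))
  where
  go : ∀ P → Acc _<_ (edgeCount P) → LongLists P L → ¬ ¬ Colourable P L
  go P (acc smaller) long stuck = critical-impossible {P = P} {L = L} record
    { long = long ; stuck = stuck ; better = λ P′ lt → go P′ (smaller lt) }

-- Lower bounds and the finite search

module _ {n} (G : Graph n) where

  neighbours : Fin n → List (Fin n)
  neighbours v = filter (λ w → T? (adj G v w)) (allFin n)

  length-neighbours : ∀ v → length (neighbours v) ≡ deg G v
  length-neighbours v = count (allFin n)
    where
    count : ∀ ws → length (filter (λ w → T? (adj G v w)) ws) ≡ sum (map (λ w → if adj G v w then 1 else 0) ws)
    count [] = refl
    count (w ∷ ws) with adj G v w
    ... | true = cong suc (count ws)
    ... | false = count ws

  edge-sym : ∀ {u v} → Edge G u v → Edge G v u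
  edge-sym {u} {v} = subst T (Graph.sym G u v)

  edge-irrefl : ∀ {u} → ¬ Edge G u u
  edge-irrefl {u} = subst T (Graph.irrefl G u)

  -- Descent on the number of crossings. A drawing that is not good yields a better one only by
  -- contradiction, so the existence stays double negated.
  ¬¬good : IsOuter1Planar G → ¬ ¬ (∃[ π ] IsGood G π)
  ¬¬good (π , plane) none = go π plane (<-wellFounded _)
    where
    go : ∀ π → IsOuter1Plane G π → Acc _<_ (crossCount8 G π) → ⊥
    go π plane (acc smaller) = none (π , plane , λ π′ plane′ → decidable-stable (_ ≤? _)
      λ worse → go π′ plane′ (smaller (≰⇒> worse)))

  not-j-colourable : ∀ {j v} → j < deg G v → ¬ EdgeColourable G j
  not-j-colourable {j} {v} lt (c , (_ , proper) , bound) = <⇒≱ lt (begin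
    deg G v                          ≡⟨ sym (length-neighbours v) ⟩
    length (neighbours v)            ≡⟨ sym (length-map (c v) (neighbours v)) ⟩
    length (map (c v) (neighbours v)) ≤⟨ length-⊆ (unique (Unique.filter⁺ (λ w → T? (adj G v w)) (Unique.allFin⁺ n)) edge) below ⟩
    length (upTo j)                  ≡⟨ length-upTo j ⟩
    j                                ∎)
    where
    open ≤-Reasoning
    edge : ∀ {w} → w ∈ neighbours v → Edge G v w
    edge m = proj₂ (∈-filter⁻ (λ w → T? (adj G v w)) {xs = allFin n} m)
    unique : ∀ {ws} → Unique ws → (∀ {w} → w ∈ ws → Edge G v w) → Unique (map (c v) ws)
    unique [] _ = []
    unique {w ∷ ws} (w∉ ∷ u) e = All.tabulate fresh ∷ unique u (e ∘ there)
      where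
      fresh : ∀ {k} → k ∈ map (c v) ws → c v w ≢ k
      fresh m eq with ∈-map⁻ (c v) m
      ... | x , x∈ , refl = proper v w x (e (here refl)) (e (there x∈)) (All.lookup w∉ x∈) eq
    below : ∀ {k} → k ∈ map (c v) (neighbours v) → k ∈ upTo j
    below m with ∈-map⁻ (c v) m
    ... | x , x∈ , refl = ∈-upTo⁺ (bound v x (edge x∈))

  choosable⇒colourable : ∀ {j} → EdgeChoosable G j → EdgeColourable G j
  choosable⇒colourable {j} ch with ch (λ _ _ → upTo j) (λ _ _ _ → refl , length-upTo j , Unique.upTo⁺ j)
  ... | c , proper , inL = c , proper , λ u v e → ∈-upTo⁻ (inL u v e)

  -- A colouring from lists of length 4 is searched for among the finitely many ways to pick
  -- a position in each list.
  module Search (L : Fin n → Fin n → List ℕ) (list : IsListAssignment G 4 L) where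

    Good : (Fin n → Fin n → ℕ) → Set
    Good c = ProperEdgeColouring G c × (∀ u v → Edge G u v → c u v ∈ L u v)

    good? : ∀ c → Dec (Good c)
    good? c =
      ((all? λ u → all? λ v → T? (adj G u v) →-dec (c u v ≟ c v u)) ×-dec
       (all? λ u → all? λ v → all? λ w → T? (adj G u v) →-dec (T? (adj G u w) →-dec
         (¬? (v ≟F w) →-dec ¬? (c u v ≟ c u w))))) ×-dec
      (all? λ u → all? λ v → T? (adj G u v) →-dec (c u v ∈? L u v))

    good-cong : ∀ {c d} → (∀ u v → Edge G u v → c u v ≡ d u v) → Good c → Good d
    good-cong eq ((s , p) , l) =
      ((λ u v e → trans (sym (eq u v e)) (trans (s u v e) (eq v u (edge-sym e)))) ,
       (λ u v w e f ne h → p u v w e f ne (trans (eq u v e) (trans h (sym (eq u w f)))))) ,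
      (λ u v e → subst (_∈ L u v) (eq u v e) (l u v e))

    entry : List ℕ → Fin 4 → ℕ
    entry [] _ = 0
    entry (x ∷ _) zero = x
    entry (_ ∷ []) (suc _) = 0
    entry (_ ∷ x ∷ _) (suc zero) = x
    entry (_ ∷ _ ∷ []) (suc (suc _)) = 0
    entry (_ ∷ _ ∷ x ∷ _) (suc (suc zero)) = x
    entry (_ ∷ _ ∷ _ ∷ []) (suc (suc (suc _))) = 0
    entry (_ ∷ _ ∷ _ ∷ x ∷ _) (suc (suc (suc zero))) = x

    position : ∀ xs → length xs ≡ 4 → ∀ {x} → x ∈ xs → ∃[ i ] entry xs i ≡ x
    position (_ ∷ _ ∷ _ ∷ _ ∷ []) refl (here e) = zero , sym e
    position (_ ∷ _ ∷ _ ∷ _ ∷ []) refl (there (here e)) = suc zero , sym e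
    position (_ ∷ _ ∷ _ ∷ _ ∷ []) refl (there (there (here e))) = suc (suc zero) , sym e
    position (_ ∷ _ ∷ _ ∷ _ ∷ []) refl (there (there (there (here e)))) = suc (suc (suc zero)) , sym e

    -- A code picks a position for each of the n * n ordered pairs. `Good` reads edges only, so the
    -- positions at other pairs, and the default 0 of `entry` on short lists, are arbitrary.
    decode : Fin (4 ^ (n * n)) → Fin n → Fin n → ℕ
    decode k u v = entry (L u v) (finToFun k (combine u v))

    encode : ∀ c → Good c → ∃[ k ] (∀ u v → Edge G u v → c u v ≡ decode k u v)
    encode c (_ , l) = funToFin (uncurry choice ∘ remQuot {n} n) , agree
      where
      choice : Fin n → Fin n → Fin 4
      choice u v with T? (adj G u v)
      ... | yes e = proj₁ (position (L u v) (proj₁ (proj₂ (list u v e))) (l u v e))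
      ... | no _ = zero
      choice-entry : ∀ u v → Edge G u v → c u v ≡ entry (L u v) (choice u v)
      choice-entry u v e with T? (adj G u v)
      ... | yes e′ = sym (proj₂ (position (L u v) (proj₁ (proj₂ (list u v e′))) (l u v e′)))
      ... | no ne = ⊥-elim (ne e)
      agree : ∀ u v → Edge G u v → c u v ≡ decode (funToFin (uncurry choice ∘ remQuot {n} n)) u v
      agree u v e = trans (choice-entry u v e) (cong (entry (L u v)) (sym (trans
        (finToFun-funToFin (uncurry choice ∘ remQuot {n} n) (combine u v))
        (cong (uncurry choice) (remQuot-combine {n} {n} u v)))))

    good-stable : ¬ ¬ (∃ Good) → ∃ Good
    good-stable nn = decidable-stable (map′ (λ (k , g) → decode k , g) into (any? (good? ∘ decode))) nn
      where
      into : ∃ Good → ∃[ k ] Good (decode k)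
      into (c , g) with encode c g
      ... | k , eq = k , good-cong eq g

-- The plane of a good drawing

module Positions {n} (G : Graph n) (π : Drawing n) where

  pos : Fin n → ℕ
  pos u = toℕ (π ⟨$⟩ʳ u)

  pos-injective : ∀ {u v} → pos u ≡ pos v → u ≡ v
  pos-injective {u} {v} e = trans (sym (inverseˡ π)) (trans (cong (π ⟨$⟩ˡ_) (toℕ-injective e)) (inverseˡ π))

  vertex : ∀ {i} → i < n → Fin n
  vertex lt = π ⟨$⟩ˡ fromℕ< lt

  pos-vertex : ∀ {i} (lt : i < n) → pos (vertex lt) ≡ i
  pos-vertex lt = trans (cong toℕ (inverseʳ π)) (toℕ-fromℕ< lt)

  vertex-pos : ∀ u (lt : pos u < n) → vertex lt ≡ u
  vertex-pos u lt = pos-injective (pos-vertex lt)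

  transport : ∀ {A : Set} → (Fin n → Fin n → A) → A → ℕ → ℕ → A
  transport f z i j with i <? n | j <? n
  ... | yes i< | yes j< = f (vertex i<) (vertex j<)
  ... | _ | _ = z

  transport-pos : ∀ {A : Set} (f : Fin n → Fin n → A) z u v → transport f z (pos u) (pos v) ≡ f u v
  transport-pos f z u v with pos u <? n | pos v <? n
  ... | yes u< | yes v< = cong₂ f (vertex-pos u u<) (vertex-pos v v<)
  ... | no ≮ | _ = ⊥-elim (≮ (toℕ<n _))
  ... | yes _ | no ≮ = ⊥-elim (≮ (toℕ<n _))

  A : ℕ → ℕ → Bool
  A = transport (adj G) false

  -- A view: matching on it replaces two adjacent positions by those of actual vertices.
  data EdgeAt : ℕ → ℕ → Set where
    edgeAt : ∀ {u v} → Edge G u v → EdgeAt (pos u) (pos v)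

  A⁻ : ∀ {i j} → T (A i j) → EdgeAt i j
  A⁻ {i} {j} t with i <? n | j <? n
  ... | yes i< | yes j< = subst₂ EdgeAt (pos-vertex i<) (pos-vertex j<) (edgeAt t)

  A⁺ : ∀ {u v} → Edge G u v → T (A (pos u) (pos v))
  A⁺ {u} {v} = subst T (sym (transport-pos (adj G) false u v))

  A-edge : ∀ {u v} → T (A (pos u) (pos v)) → Edge G u v
  A-edge {u} {v} = subst T (transport-pos (adj G) false u v)

  A-sym : ∀ {i j} → T (A i j) → T (A j i)
  A-sym t with A⁻ t
  ... | edgeAt e = A⁺ (edge-sym G e)

  private
    sep-before : ∀ {a c b} → pos a < pos b → pos b < pos c → sepB π a c b ≡ true
    sep-before {a} {c} {b} p q with pos a <ᵇ pos b in e | pos b <ᵇ pos c in f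
    ... | true | true = refl
    ... | false | _ = ⊥-elim (subst T e (<⇒<ᵇ p))
    ... | true | false = ⊥-elim (subst T f (<⇒<ᵇ q))

    sep-after : ∀ {a c d} → pos a < pos c → pos c < pos d → sepB π a c d ≡ false
    sep-after {a} {c} {d} p q with pos d <ᵇ pos c in e | pos d <ᵇ pos a in f
    ... | true | _ = ⊥-elim (<-asym q (<ᵇ⇒< _ _ (subst T (sym e) tt)))
    ... | false | true = ⊥-elim (<-asym (<-trans p q) (<ᵇ⇒< _ _ (subst T (sym f) tt)))
    ... | false | false with pos a <ᵇ pos d | pos c <ᵇ pos d
    ...   | true | true = refl
    ...   | true | false = refl
    ...   | false | true = refl
    ...   | false | false = refl

    pos-< : ∀ {u v} → pos u < pos v → u ≢ v
    pos-< lt refl = <-irrefl refl lt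

  cross : ∀ {a b c d} → pos a < pos b → pos b < pos c → pos c < pos d → Edge G a c → Edge G b d →
    Cross G π a c b d
  cross {a} {b} {c} {d} p q r ac bd
    with adj G a c | adj G b d | b ≟F a | b ≟F c | d ≟F a | d ≟F c
       | sepB π a c b | sep-before {a} {c} {b} p q | sepB π a c d | sep-after {a} {c} {d} (<-trans p q) r
  ... | true | true | yes e | _ | _ | _ | _ | _ | _ | _ = ⊥-elim (pos-< p (sym e))
  ... | true | true | no _ | yes e | _ | _ | _ | _ | _ | _ = ⊥-elim (pos-< q e)
  ... | true | true | no _ | no _ | yes e | _ | _ | _ | _ | _ = ⊥-elim (pos-< (<-trans p (<-trans q r)) (sym e))
  ... | true | true | no _ | no _ | no _ | yes e | _ | _ | _ | _ = ⊥-elim (pos-< r (sym e))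
  ... | true | true | no _ | no _ | no _ | no _ | _ | refl | _ | refl = tt

  -- Of all ways in which two pairs of edges can agree as sets, only the identity respects the order
  -- of the positions.
  same-crossing : ∀ {a b c d a′ b′ c′ d′} →
    pos a < pos b → pos b < pos c → pos c < pos d →
    pos a′ < pos b′ → pos b′ < pos c′ → pos c′ < pos d′ →
    SameCrossing a c b d a′ c′ b′ d′ → a ≡ a′ × b ≡ b′ × c ≡ c′ × d ≡ d′
  same-crossing p q r p′ q′ r′ (inj₁ (inj₁ (refl , refl) , inj₁ (refl , refl))) = refl , refl , refl , refl
  same-crossing p q r p′ q′ r′ (inj₁ (inj₂ (refl , refl) , _)) = ⊥-elim (<-asym (<-trans p q) (<-trans p′ q′))
  same-crossing p q r p′ q′ r′ (inj₁ (inj₁ _ , inj₂ (refl , refl))) = ⊥-elim (<-asym (<-trans q r) (<-trans q′ r′))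
  same-crossing p q r p′ q′ r′ (inj₂ (inj₁ (refl , refl) , inj₁ (refl , refl))) = ⊥-elim (<-asym p p′)
  same-crossing p q r p′ q′ r′ (inj₂ (inj₁ (refl , refl) , inj₂ (refl , refl))) = ⊥-elim (<-asym (<-trans p (<-trans q r)) p′)
  same-crossing p q r p′ q′ r′ (inj₂ (inj₂ (refl , refl) , _)) = ⊥-elim (<-asym (<-trans p q) (<-trans q′ r′))

  module _ (max : MaxDegree G 4) (good : IsGood G π) (far : CrossingDistanceAtLeast G 3) where

    private
      -- The walk goes through `v`; its bound 2 is the `pred 3` of the hypothesis on crossings.
      walk : ∀ {x y v} → Within1 A (pos x) v → Within1 A (pos y) v → DistLE G 2 x y
      walk {x} {y} (inj₁ e) (inj₁ f) = 0 , z≤n , subst (λ z → Walk G x z 0) (pos-injective (trans e (sym f))) here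
      walk (inj₁ refl) (inj₂ f) = 1 , s≤s z≤n , step (edge-sym G (A-edge f)) here
      walk (inj₂ e) (inj₁ refl) = 1 , s≤s z≤n , step (A-edge e) here
      walk {x} {y} (inj₂ e) (inj₂ f) = two (A⁻ e) refl e f
        where
        two : ∀ {i v} → EdgeAt i v → i ≡ pos x → T (A (pos x) v) → T (A (pos y) v) → DistLE G 2 x y
        two (edgeAt _) _ e f = 2 , ≤-refl , step (A-edge e) (step (edge-sym G (A-edge f)) here)

      neighbours-≤ : ∀ i → length (nbrs A n i) ≤ 4
      neighbours-≤ i with nbrs A n i in eq
      ... | [] = z≤n
      ... | j ∷ js with ∈-filter⁻ (λ v → T? (A i v)) {xs = upTo n} (subst (j ∈_) (sym eq) (here refl))
      ...   | _ , t = subst (λ xs → length xs ≤ 4) eq (bound (A⁻ t))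
        where
        bound : ∀ {i j} → EdgeAt i j → length (nbrs A n i) ≤ 4
        bound (edgeAt {u} _) = begin
          length (nbrs A n (pos u))              ≤⟨ length-⊆ (Unique.filter⁺ (λ v → T? (A (pos u) v)) (Unique.upTo⁺ n))
                                                      (λ m → image (proj₂ (∈-filter⁻ (λ v → T? (A (pos u) v)) {xs = upTo n} m))) ⟩
          length (map pos (neighbours G u))      ≡⟨ length-map pos (neighbours G u) ⟩
          length (neighbours G u)                ≡⟨ length-neighbours G u ⟩
          deg G u                           ≤⟨ proj₁ max u ⟩
          4                                      ∎
          where
          open ≤-Reasoning
          image : ∀ {j} → T (A (pos u) j) → j ∈ map pos (neighbours G u)
          image t with A⁻ t in eq
          ... | e = from e refl t
            where
            from : ∀ {i j} → EdgeAt i j → i ≡ pos u → T (A (pos u) j) → j ∈ map pos (neighbours G u)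
            from (edgeAt {v = v} _) _ t = ∈-map⁺ pos (∈-filter⁺ (λ w → T? (adj G u w)) (∈-allFin v) (A-edge t))

      data At : ℕ → Set where
        at-pos : ∀ u → At (pos u)

      at? : ∀ {i j} → T (A i j) → At i × At j
      at? t with A⁻ t
      ... | edgeAt {u} {v} _ = at-pos u , at-pos v

      -- The list has the ends of ac before those of bd, as for a crossing of the drawing, whereas
      -- `OneOf` follows the circle.
      pick∈ : ∀ {a b c d x} → OneOf (pos a) (pos b) (pos c) (pos d) x →
        ∃[ u ] (x ≡ pos u × u ∈ a ∷ c ∷ b ∷ d ∷ [])
      pick∈ 1st = _ , refl , here refl
      pick∈ 2nd = _ , refl , there (there (here refl))
      pick∈ 3rd = _ , refl , there (here refl)
      pick∈ 4th = _ , refl , there (there (there (here refl)))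

      separate : ∀ {a b c d a′ b′ c′ d′ x y v} → Crossing A a b c d → Crossing A a′ b′ c′ d′ →
        OneOf a b c d x → OneOf a′ b′ c′ d′ y → Within1 A x v → Within1 A y v →
        a ≡ a′ × b ≡ b′ × c ≡ c′ × d ≡ d′
      separate {a} {b} {c} {d} {a′} {b′} {c′} {d′} (p , q , r , ac , bd) (p′ , q′ , r′ , ac′ , bd′) o o′ w w′
        with (a ≟ a′) ×-dec ((b ≟ b′) ×-dec ((c ≟ c′) ×-dec (d ≟ d′)))
      ... | yes same = same
      ... | no differ with at? ac | at? bd | at? ac′ | at? bd′
      ...   | at-pos a , at-pos c | at-pos b , at-pos d | at-pos a′ , at-pos c′ | at-pos b′ , at-pos d′
        with pick∈ {a} {b} {c} {d} o | pick∈ {a′} {b′} {c′} {d′} o′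
      ...     | x , refl , x∈ | y , refl , y∈ =
        ⊥-elim (far π good a c b d a′ c′ b′ d′ (cross p q r (A-edge ac) (A-edge bd)) (cross p′ q′ r′ (A-edge ac′) (A-edge bd′))
          (λ s → differ (positions (same-crossing p q r p′ q′ r′ s))) x y x∈ y∈ (walk w w′))
        where
        positions : ∀ {a b c d a′ b′ c′ d′} → a ≡ a′ × b ≡ b′ × c ≡ c′ × d ≡ d′ →
          pos a ≡ pos a′ × pos b ≡ pos b′ × pos c ≡ pos c′ × pos d ≡ pos d′
        positions (refl , refl , refl , refl) = refl , refl , refl , refl

    plane : Plane n
    plane = record
      { E = A
      ; E-sym = A-sym
      ; E-irr = irr
      ; E-bound = bound
      ; deg≤4 = neighbours-≤
      ; apart = separate
      }
      where
      irr : ∀ {i} → ¬ T (A i i)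
      irr {i} t with proj₁ (at? t)
      ... | at-pos u = edge-irrefl G (A-edge t)
      bound : ∀ {i j} → T (A i j) → i < n
      bound t with A⁻ t
      ... | edgeAt _ = toℕ<n _

    not-unlistable : ∀ L → IsListAssignment G 4 L →
      ¬ ¬ (∃[ c ] (ProperEdgeColouring G c × (∀ u v → Edge G u v → c u v ∈ L u v)))
    not-unlistable L list none = not-uncolourable plane (transport L []) long λ { (c , c-sym , c-proper , c-list) →
      none ((λ u v → c (pos u) (pos v)) ,
        ((λ u v e → c-sym (A⁺ e)) ,
         (λ u v w e f v≢w → c-proper (A⁺ e) (A⁺ f) (v≢w ∘ pos-injective))) ,
        (λ u v e → subst (c (pos u) (pos v) ∈_) (transport-pos L [] u v) (c-list (A⁺ e)))) }
      where
      long : LongLists plane (transport L [])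
      long t with A⁻ t
      ... | edgeAt {u} {v} e rewrite transport-pos L [] u v | transport-pos L [] v u with list u v e
      ...   | s , four , uniq = s , ≤-reflexive (sym four) , uniq

theorem1p1 : ∀ {n : ℕ} (G : Graph n) → IsOuter1Planar G → MaxDegree G 4 →
    CrossingDistanceAtLeast G 3 →
    ListEdgeChromaticNumber G 4 × EdgeChromaticNumber G 4
theorem1p1 G planar max@(_ , v , four) far =
  (choosable , λ j j<4 → not-j-colourable G (subst (j <_) (sym four) j<4) ∘ choosable⇒colourable G) ,
  (choosable⇒colourable G choosable , λ j j<4 → not-j-colourable G (subst (j <_) (sym four) j<4))
  where
  choosable : EdgeChoosable G 4
  -- The finite search strips the double negations of both the good drawing and the colouring.
  choosable L list = Search.good-stable G L list λ none → ¬¬good G planar λ (π , good) →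
    Positions.not-unlistable G π max good far L list none
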